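{- Let $\ell\ge3$ be a prime and $t=2$. Then $\mu_\ell(X_2,\alpha)=0$ for all $\alpha\in\mathbb{Z}_\ell^2\setminus(\ell\mathbb{Z}_\ell)^2$. If $\ell\equiv3\pmod 4$, then $\lambda_\ell(X_2,\alpha)=1$ for all such $\alpha$. If $\ell\equiv1\pmod4$, then $$\mathrm{Prob}_\ell(X_2;\mu=0,\lambda=\lambda_0)=\begin{cases}\frac{\ell-1}{\ell+1}&\text{if }\lambda_0=1,\\ \frac{2}{\ell+1}&\text{if }\lambda_0=3,\\ 0&\text{otherwise.}\end{cases}$$
   Context: For $b\in\mathbb{Z}_\ell$ put $\binom{b}{n}=\frac{b(b-1)\cdots(b-n+1)}{n!}\in\mathbb{Z}_\ell$ and $(1+T)^b=\sum_{n\ge0}\binom{b}{n}T^n\in\mathbb{Z}_\ell[[T]]$. The bouquet $X_t$ is the multigraph with one vertex and $t$ undirected loops; a vector $\alpha=(\alpha_1,\dots,\alpha_t)\in\mathbb{Z}_\ell^t$ assigns the voltage $\alpha_j$ to the $j$-th loop. It is admissible if $\alpha\in\mathbb{Z}_\ell^t\setminus(\ell\mathbb{Z}_\ell)^t$. The characteristic series is $$f(T)=f_{X_t,\alpha}(T)=\sum_{j=1}^t\big(2-(1+T)^{\alpha_j}-(1+T)^{ -\alpha_j}\big)\in\mathbb{Z}_\ell[[T]].$$ For admissible $\alpha$ it is nonzero, and it has zero constant term. By Weierstrass preparation write $f(T)=\ell^{\mu}g(T)u(T)$ with $\mu\in\mathbb{Z}_{\ge0}$, $g$ a distinguished polynomial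 (monic, all non-leading coefficients divisible by $\ell$) and $u\in\mathbb{Z}_\ell[[T]]^\times$. Then $\mu_\ell(X_t,\alpha):=\mu$ and $\lambda_\ell(X_t,\alpha):=\deg g-1$ (note the shift by $-1$). Let $\tau$ be the Haar measure on $\mathbb{Z}_\ell^t$ normalized by $\tau(\mathbb{Z}_\ell^t)=1$, so $\tau(\mathbb{Z}_\ell^t\setminus(\ell\mathbb{Z}_\ell)^t)=1-\ell^{ -t}$. Define $$\mathrm{Prob}_\ell(X_t;\mu=\mu_0,\lambda=\lambda_0)=(1-\ell^{ -t})^{ -1}\,\tau\big(\{\alpha\in\mathbb{Z}_\ell^t\setminus(\ell\mathbb{Z}_\ell)^t:\mu_\ell(X_t,\alpha)=\mu_0,\ \lambda_\ell(X_t,\alpha)=\lambda_0\}\big).$$ -}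

module Defs where

open import Algebra.Bundles using (CommutativeRing)
import Algebra.Definitions.RawMagma as RawMagmaDefinitions
import Algebra.Properties.Group as GroupProperties
import Algebra.Properties.Monoid.Sum as MonoidSum
open import Data.Empty using (⊥-elim)
open import Data.Fin.Base using (toℕ)
open import Data.Integer.Base as ℤ using (ℤ; +_)
open import Data.Integer.Coprimality using (coprime-divisor)
open import Data.Integer.Divisibility.Signed as ℤ∣ using (_∣_; divides)
import Data.Integer.DivMod as ℤ/
import Data.Integer.Properties as ℤ
open import Data.Integer.Tactic.RingSolver using (solve-∀)
open import Data.Maybe.Base using (Maybe; maybe′)
open import Data.Maybe.Relation.Unary.Any using (Any)
open import Data.Nat.Base as ℕ using (ℕ; zero; suc; _!; z≤n; s≤s)
open import Data.Nat.Combinatorics using (_C_; k>n⇒nCk≡0; nCk+nC[k+1]≡[n+1]C[k+1])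
import Data.Nat.Divisibility as ℕ∣
open import Data.Nat.Coprimality using (Coprime)
open import Data.Nat.Primality using (Prime; prime⇒nonZero; prime⇒nonTrivial; prime⇒irreducible)
import Data.Nat.Properties as ℕ
open import Data.Product.Base using (∃-syntax; _×_; _,_; proj₁)
open import Data.Rational.Base as ℚ using (ℚ; 0ℚ; 1ℚ)
import Data.Rational.Properties as ℚ
open import Data.Sum.Base using (inj₁; inj₂)
open import Data.Vec.Functional using (Vector)
open import Level using (0ℓ)
open import Relation.Binary.PropositionalEquality
open import Relation.Nullary using (¬_; yes; no)
open import Relation.Unary using (Pred; _⊆_; ∁)

fallingℤ : ℤ → ℕ → ℤ
fallingℤ a zero    = + 1
fallingℤ a (suc n) = fallingℤ a n ℤ.* (a ℤ.- + n)

pos-suc : ∀ n → + suc n ≡ + 1 ℤ.+ + n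
pos-suc n = ℤ.pos-+ 1 n

fallingℤ-suc : ∀ a n → fallingℤ (+ 1 ℤ.+ a) (suc n) ≡ (+ 1 ℤ.+ a) ℤ.* fallingℤ a n
fallingℤ-suc a zero = lem a where
  lem : ∀ a → + 1 ℤ.* (+ 1 ℤ.+ a ℤ.- + 0) ≡ (+ 1 ℤ.+ a) ℤ.* + 1
  lem = solve-∀
fallingℤ-suc a (suc n) = begin
  fallingℤ (+ 1 ℤ.+ a) (suc n) ℤ.* (+ 1 ℤ.+ a ℤ.- + suc n)
    ≡⟨ cong₂ (λ x y → x ℤ.* (+ 1 ℤ.+ a ℤ.- y)) (fallingℤ-suc a n) (pos-suc n) ⟩
  ((+ 1 ℤ.+ a) ℤ.* fallingℤ a n) ℤ.* (+ 1 ℤ.+ a ℤ.- (+ 1 ℤ.+ + n))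
    ≡⟨ lem a (fallingℤ a n) (+ n) ⟩
  (+ 1 ℤ.+ a) ℤ.* (fallingℤ a n ℤ.* (a ℤ.- + n)) ∎
  where
  open ≡-Reasoning
  lem : ∀ a x y → ((+ 1 ℤ.+ a) ℤ.* x) ℤ.* (+ 1 ℤ.+ a ℤ.- (+ 1 ℤ.+ y))
                ≡ (+ 1 ℤ.+ a) ℤ.* (x ℤ.* (a ℤ.- y))
  lem = solve-∀

fallingℤ≡!*C : ∀ m n → fallingℤ (+ m) n ≡ + (n !) ℤ.* + (m C n)
fallingℤ≡!*C m       zero    = refl
fallingℤ≡!*C zero    (suc n) = begin
  fallingℤ (+ 0) (suc n)          ≡⟨ zeroes n ⟩
  + 0                             ≡⟨ ℤ.*-zeroʳ (+ (suc n !)) ⟨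
  + (suc n !) ℤ.* + 0             ≡⟨ cong (λ x → + (suc n !) ℤ.* + x) (k>n⇒nCk≡0 {0} {suc n} (s≤s z≤n)) ⟨
  + (suc n !) ℤ.* + (0 C suc n)   ∎
  where
  open ≡-Reasoning
  zeroes : ∀ n → fallingℤ (+ 0) (suc n) ≡ + 0
  zeroes zero    = refl
  zeroes (suc n) = cong (ℤ._* (+ 0 ℤ.- + suc n)) (zeroes n)
fallingℤ≡!*C (suc m) (suc n) = begin
  fallingℤ (+ suc m) (suc n)
    ≡⟨ cong (λ x → fallingℤ x (suc n)) (pos-suc m) ⟩
  fallingℤ (+ 1 ℤ.+ + m) (suc n)
    ≡⟨ fallingℤ-suc (+ m) n ⟩
  (+ 1 ℤ.+ + m) ℤ.* fallingℤ (+ m) n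
    ≡⟨ split (+ m) (+ n) (fallingℤ (+ m) n) ⟩
  fallingℤ (+ m) (suc n) ℤ.+ (+ 1 ℤ.+ + n) ℤ.* fallingℤ (+ m) n
    ≡⟨ cong₂ (λ x y → x ℤ.+ (+ 1 ℤ.+ + n) ℤ.* y) (fallingℤ≡!*C m (suc n)) (fallingℤ≡!*C m n) ⟩
  + (suc n !) ℤ.* + (m C suc n) ℤ.+ (+ 1 ℤ.+ + n) ℤ.* (+ (n !) ℤ.* + (m C n))
    ≡⟨ cong (λ x → + (suc n !) ℤ.* + (m C suc n) ℤ.+ x) (ℤ.*-assoc (+ 1 ℤ.+ + n) (+ (n !)) (+ (m C n))) ⟨
  + (suc n !) ℤ.* + (m C suc n) ℤ.+ ((+ 1 ℤ.+ + n) ℤ.* + (n !)) ℤ.* + (m C n)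
    ≡⟨ cong (λ x → + (suc n !) ℤ.* + (m C suc n) ℤ.+ x ℤ.* + (m C n))
         (trans (cong (ℤ._* + (n !)) (sym (pos-suc n))) (sym (ℤ.pos-* (suc n) (n !)))) ⟩
  + (suc n !) ℤ.* + (m C suc n) ℤ.+ + (suc n !) ℤ.* + (m C n)
    ≡⟨ collect (+ (suc n !)) (+ (m C suc n)) (+ (m C n)) ⟩
  + (suc n !) ℤ.* (+ (m C n) ℤ.+ + (m C suc n))
    ≡⟨ cong (+ (suc n !) ℤ.*_) (ℤ.pos-+ (m C n) (m C suc n)) ⟨
  + (suc n !) ℤ.* + (m C n ℕ.+ m C suc n)
    ≡⟨ cong (λ x → + (suc n !) ℤ.* + x) (nCk+nC[k+1]≡[n+1]C[k+1] m n) ⟩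
  + (suc n !) ℤ.* + (suc m C suc n) ∎
  where
  open ≡-Reasoning
  split : ∀ m n x → (+ 1 ℤ.+ m) ℤ.* x ≡ x ℤ.* (m ℤ.- n) ℤ.+ (+ 1 ℤ.+ n) ℤ.* x
  split = solve-∀
  collect : ∀ a x y → a ℤ.* x ℤ.+ a ℤ.* y ≡ a ℤ.* (y ℤ.+ x)
  collect = solve-∀

module ℓ-adic (ℓ : ℕ) (ℓ-prime : Prime ℓ) where

  private instance
    ℓ≢0 : ℕ.NonZero ℓ
    ℓ≢0 = prime⇒nonZero ℓ-prime

  ℓ^_ : ℕ → ℤ
  ℓ^ n = + (ℓ ℕ.^ n)

  -- Records rather than functions, here and in _≈_, so that the
  -- arguments can be inferred.
  infix 4 _≡_mod-ℓ^_
  record _≡_mod-ℓ^_ (a b : ℤ) (n : ℕ) : Set where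
    constructor mk≡mod
    field ℓ^n∣a-b : ℓ^ n ∣ a ℤ.- b
  open _≡_mod-ℓ^_ public

  ----------------------------------------------------------------------
  -- ℤ_ℓ as the inverse limit of the rings ℤ/ℓⁿ: a coherent sequence of
  -- integers, its n-th entry mattering only modulo ℓⁿ.

  record ℤ_ℓ : Set where
    constructor mkℤ_ℓ
    field
      residue  : ℕ → ℤ
      coherent : ∀ n → residue (suc n) ≡ residue n mod-ℓ^ n
  open ℤ_ℓ public

  infix 4 _≈_
  record _≈_ (x y : ℤ_ℓ) : Set where
    constructor mk≈
    field residue-≈ : ∀ n → residue x n ≡ residue y n mod-ℓ^ n
  open _≈_ public

  abstract
    mod-by : ∀ {n a b c} → c ≡ a ℤ.- b → ℓ^ n ∣ c → a ≡ b mod-ℓ^ n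
    mod-by {n} eq d = mk≡mod (subst (ℓ^ n ∣_) eq d)

    ≡⇒mod : ∀ {n a b} → a ≡ b → a ≡ b mod-ℓ^ n
    ≡⇒mod {n} {a} {b} eq =
      mk≡mod (divides (+ 0) (trans (cong (ℤ._- b) eq) (ℤ.+-inverseʳ b)))

    mod-sym : ∀ {n a b} → a ≡ b mod-ℓ^ n → b ≡ a mod-ℓ^ n
    mod-sym {n} {a} {b} (mk≡mod p) = mod-by (lem a b) (ℤ∣.∣m⇒∣-m p)
      where lem : ∀ a b → ℤ.- (a ℤ.- b) ≡ b ℤ.- a
            lem = solve-∀

    mod-trans : ∀ {n a b c} → a ≡ b mod-ℓ^ n → b ≡ c mod-ℓ^ n → a ≡ c mod-ℓ^ n
    mod-trans {n} {a} {b} {c} (mk≡mod p) (mk≡mod q) = mod-by (lem a b c) (ℤ∣.∣m∣n⇒∣m+n p q)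
      where lem : ∀ a b c → (a ℤ.- b) ℤ.+ (b ℤ.- c) ≡ a ℤ.- c
            lem = solve-∀

    mod-+ : ∀ {n a b c d} → a ≡ b mod-ℓ^ n → c ≡ d mod-ℓ^ n → a ℤ.+ c ≡ b ℤ.+ d mod-ℓ^ n
    mod-+ {n} {a} {b} {c} {d} (mk≡mod p) (mk≡mod q) = mod-by (lem a b c d) (ℤ∣.∣m∣n⇒∣m+n p q)
      where lem : ∀ a b c d → (a ℤ.- b) ℤ.+ (c ℤ.- d) ≡ (a ℤ.+ c) ℤ.- (b ℤ.+ d)
            lem = solve-∀

    mod-neg : ∀ {n a b} → a ≡ b mod-ℓ^ n → ℤ.- a ≡ ℤ.- b mod-ℓ^ n
    mod-neg {n} {a} {b} (mk≡mod p) = mod-by (lem a b) (ℤ∣.∣m⇒∣-m p)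
      where lem : ∀ a b → ℤ.- (a ℤ.- b) ≡ (ℤ.- a) ℤ.- (ℤ.- b)
            lem = solve-∀

    mod-* : ∀ {n a b c d} → a ≡ b mod-ℓ^ n → c ≡ d mod-ℓ^ n → a ℤ.* c ≡ b ℤ.* d mod-ℓ^ n
    mod-* {n} {a} {b} {c} {d} (mk≡mod p) (mk≡mod q) =
      mod-by (lem a b c d) (ℤ∣.∣m∣n⇒∣m+n (ℤ∣.∣m⇒∣m*n c p) (ℤ∣.∣n⇒∣m*n b q))
      where lem : ∀ a b c d → (a ℤ.- b) ℤ.* c ℤ.+ b ℤ.* (c ℤ.- d) ≡ a ℤ.* c ℤ.- b ℤ.* d
            lem = solve-∀

  pointwise : ∀ {x y} → (∀ n → residue x n ≡ residue y n) → x ≈ y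
  pointwise eq = mk≈ λ n → ≡⇒mod (eq n)

  infixl 6 _+_
  infixl 7 _*_
  infix  8 -_

  _+_ _*_ : ℤ_ℓ → ℤ_ℓ → ℤ_ℓ
  x + y = mkℤ_ℓ (λ n → residue x n ℤ.+ residue y n) (λ n → mod-+ (coherent x n) (coherent y n))
  x * y = mkℤ_ℓ (λ n → residue x n ℤ.* residue y n) (λ n → mod-* (coherent x n) (coherent y n))

  -_ : ℤ_ℓ → ℤ_ℓ
  - x = mkℤ_ℓ (λ n → ℤ.- residue x n) (λ n → mod-neg (coherent x n))

  fromℤ : ℤ → ℤ_ℓ
  fromℤ a = mkℤ_ℓ (λ _ → a) (λ n → ≡⇒mod refl)

  +-*-commutativeRing : CommutativeRing 0ℓ 0ℓ
  +-*-commutativeRing = record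
    { Carrier = ℤ_ℓ ; _≈_ = _≈_ ; _+_ = _+_ ; _*_ = _*_ ; -_ = -_
    ; 0# = fromℤ (+ 0) ; 1# = fromℤ (+ 1)
    ; isCommutativeRing = record
      { isRing = record
        { +-isAbelianGroup = record
          { isGroup = record
            { isMonoid = record
              { isSemigroup = record
                { isMagma = record
                  { isEquivalence = record
                    { refl  = pointwise λ _ → refl
                    ; sym   = λ p → mk≈ λ n → mod-sym (residue-≈ p n)
                    ; trans = λ p q → mk≈ λ n → mod-trans (residue-≈ p n) (residue-≈ q n)
                    }
                  ; ∙-cong = λ p q → mk≈ λ n → mod-+ (residue-≈ p n) (residue-≈ q n)
                  }
                ; assoc = λ x y z → pointwise λ n → ℤ.+-assoc (residue x n) _ _
                }
              ; identity = (λ x → pointwise λ n → ℤ.+-identityˡ (residue x n))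
                         , (λ x → pointwise λ n → ℤ.+-identityʳ (residue x n))
              }
            ; inverse = (λ x → pointwise λ n → ℤ.+-inverseˡ (residue x n))
                      , (λ x → pointwise λ n → ℤ.+-inverseʳ (residue x n))
            ; ⁻¹-cong = λ p → mk≈ λ n → mod-neg (residue-≈ p n)
            }
          ; comm = λ x y → pointwise λ n → ℤ.+-comm (residue x n) _
          }
        ; *-cong = λ p q → mk≈ λ n → mod-* (residue-≈ p n) (residue-≈ q n)
        ; *-assoc = λ x y z → pointwise λ n → ℤ.*-assoc (residue x n) _ _
        ; *-identity = (λ x → pointwise λ n → ℤ.*-identityˡ (residue x n))
                     , (λ x → pointwise λ n → ℤ.*-identityʳ (residue x n))
        ; distrib = (λ x y z → pointwise λ n → ℤ.*-distribˡ-+ (residue x n) (residue y n) (residue z n))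
                  , (λ x y z → pointwise λ n → ℤ.*-distribʳ-+ (residue x n) (residue y n) (residue z n))
        }
      ; *-comm = λ x y → pointwise λ n → ℤ.*-comm (residue x n) _
      }
    }

  open CommutativeRing +-*-commutativeRing public
    using (_-_; 0#; 1#; +-monoid; *-rawMagma)
  open MonoidSum +-monoid public using (sum)
  open RawMagmaDefinitions *-rawMagma public using () renaming (_∣_ to _∣ₗ_)

  ----------------------------------------------------------------------
  -- Binomial coefficients.

  -- b (b - 1) ⋯ (b - n + 1)
  falling : ℤ_ℓ → ℕ → ℤ_ℓ
  falling b zero    = 1#
  falling b (suc n) = falling b n * (b - fromℤ (+ n))

  residue-falling : ∀ b n k → residue (falling b n) k ≡ fallingℤ (residue b k) n
  residue-falling b zero    k = refl
  residue-falling b (suc n) k = cong (ℤ._* (residue b k ℤ.- + n)) (residue-falling b n k)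

  mod-falling : ∀ {k a b} n → a ≡ b mod-ℓ^ k → fallingℤ a n ≡ fallingℤ b n mod-ℓ^ k
  mod-falling zero p = ≡⇒mod refl
  mod-falling (suc n) p = mod-* (mod-falling n p) (mod-+ p (≡⇒mod refl))

  ℓ^-∣ : ∀ {m n} → m ℕ.≤ n → ℓ^ m ∣ ℓ^ n
  ℓ^-∣ {m} {n} m≤n = ℤ∣.∣ᵤ⇒∣ ℓᵐ∣ℓⁿ
    where
    ℓᵐ∣ℓⁿ : ℓ ℕ.^ m ℕ∣.∣ ℓ ℕ.^ n
    ℓᵐ∣ℓⁿ = subst (λ x → ℓ ℕ.^ m ℕ∣.∣ ℓ ℕ.^ x) (ℕ.m+[n∸m]≡n m≤n)
      (subst (ℓ ℕ.^ m ℕ∣.∣_) (sym (ℕ.^-distribˡ-+-* ℓ m (n ℕ.∸ m))) (ℕ∣.m∣m*n _))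

  weaken : ∀ {m n a b} → m ℕ.≤ n → a ≡ b mod-ℓ^ n → a ≡ b mod-ℓ^ m
  weaken m≤n (mk≡mod p) = mk≡mod (ℤ∣.∣-trans (ℓ^-∣ m≤n) p)

  coherent+ : ∀ x k j → residue x (j ℕ.+ k) ≡ residue x k mod-ℓ^ k
  coherent+ x k zero    = ≡⇒mod refl
  coherent+ x k (suc j) =
    mod-trans (weaken (ℕ.m≤n+m k j) (coherent x (j ℕ.+ k))) (coherent+ x k j)

  coprime-ℓ : ∀ {n} → ¬ ℓ ℕ∣.∣ n → Coprime ℓ n
  coprime-ℓ ℓ∤n (d∣ℓ , d∣n) with prime⇒irreducible ℓ-prime d∣ℓ
  ... | inj₁ d≡1  = d≡1
  ... | inj₂ refl = ⊥-elim (ℓ∤n d∣n)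

  -- A factor prime to ℓ, one power of ℓ at a time.
  cancel-unit : ∀ n e → ¬ ℓ ℕ∣.∣ n → ∀ j → ℓ^ j ∣ + n ℤ.* e → ℓ^ j ∣ e
  cancel-unit n e ℓ∤n zero    p = divides e (sym (ℤ.*-identityʳ e))
  cancel-unit n e ℓ∤n (suc j) p with cancel-unit n e ℓ∤n j (ℤ∣.∣-trans (ℓ^-∣ (ℕ.n≤1+n j)) p)
  ... | divides q refl = subst (_∣ q ℤ.* ℓ^ j) (sym (ℤ.pos-* ℓ (ℓ ℕ.^ j))) (ℤ∣.*-monoˡ-∣ (ℓ^ j) ℓ∣q)
    where
    instance
      ℓʲ≢0 : ℤ.NonZero (ℓ^ j)
      ℓʲ≢0 = ℕ.m^n≢0 ℓ j
    ℓ∣nq : + ℓ ∣ + n ℤ.* q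
    ℓ∣nq = ℤ∣.*-cancelʳ-∣ (ℓ^ j)
      (subst₂ _∣_ (ℤ.pos-* ℓ (ℓ ℕ.^ j)) (sym (ℤ.*-assoc (+ n) q (ℓ^ j))) p)
    ℓ∣q : + ℓ ∣ q
    ℓ∣q = ℤ∣.∣ᵤ⇒∣ (coprime-divisor (+ ℓ) (+ n) q (coprime-ℓ ℓ∤n) (ℤ∣.∣⇒∣ᵤ ℓ∣nq))

  1<ℓ : 1 ℕ.< ℓ
  1<ℓ = ℕ.nonTrivial⇒n>1 ℓ {{prime⇒nonTrivial ℓ-prime}}

  cancel : ∀ s n e j → 0 ℕ.< n → n ℕ.≤ s → ℓ^ (s ℕ.+ j) ∣ + n ℤ.* e → ℓ^ j ∣ e
  cancel s n e j 0<n n≤s p with ℓ ℕ∣.∣? n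
  ... | no ℓ∤n = cancel-unit n e ℓ∤n j (ℤ∣.∣-trans (ℓ^-∣ (ℕ.m≤n+m j s)) p)
  cancel zero n e j 0<n n≤0 p | yes _ = ⊥-elim (ℕ.<⇒≱ 0<n n≤0)
  cancel (suc s) n e j 0<n n≤1+s p | yes (ℕ∣.divides m refl) =
    cancel s m e j 0<m m≤s (ℤ∣.*-cancelˡ-∣ (+ ℓ)
      (subst₂ _∣_ (ℤ.pos-* ℓ (ℓ ℕ.^ (s ℕ.+ j))) move p))
    where
    0<m : 0 ℕ.< m
    0<m = ℕ.n≢0⇒n>0 λ { refl → ℕ.<-irrefl refl 0<n }
    m≤s : m ℕ.≤ s
    m≤s = ℕ.s≤s⁻¹ (ℕ.≤-trans (ℕ.m<m*n m ℓ {{ℕ.>-nonZero 0<m}} 1<ℓ) n≤1+s)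
    move : + (m ℕ.* ℓ) ℤ.* e ≡ + ℓ ℤ.* (+ m ℤ.* e)
    move = trans (cong (ℤ._* e) (ℤ.pos-* m ℓ)) (lem (+ m) (+ ℓ) e)
      where lem : ∀ a b c → (a ℤ.* b) ℤ.* c ≡ b ℤ.* (a ℤ.* c)
            lem = solve-∀

  cancel-! : ∀ n {a b} k → + (n !) ℤ.* a ≡ + (n !) ℤ.* b mod-ℓ^ (n ! ℕ.+ k) → a ≡ b mod-ℓ^ k
  cancel-! n {a} {b} k (mk≡mod p) = mk≡mod (cancel (n !) (n !) (a ℤ.- b) k (ℕ.1≤n! n) ℕ.≤-refl
    (subst (ℓ^ (n ! ℕ.+ k) ∣_) (lem (+ (n !)) a b) p))
    where
    lem : ∀ f a b → f ℤ.* a ℤ.- f ℤ.* b ≡ f ℤ.* (a ℤ.- b)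
    lem = solve-∀

  ℓ^≢0 : ∀ k → ℕ.NonZero (ℓ ℕ.^ k)
  ℓ^≢0 k = ℕ.m^n≢0 ℓ k

  natural : ℤ → ℕ → ℕ
  natural a k = (a ℤ/.%ℕ (ℓ ℕ.^ k)) {{ℓ^≢0 k}}

  natural-mod : ∀ a k → + natural a k ≡ a mod-ℓ^ k
  natural-mod a k = mod-sym (mk≡mod (divides q
    (trans (cong (ℤ._- + natural a k) (ℤ/.a≡a%ℕn+[a/ℕn]*n a (ℓ ℕ.^ k) {{ℓ^≢0 k}}))
           (lem (+ natural a k) (q ℤ.* ℓ^ k)))))
    where
    q : ℤ
    q = (a ℤ/./ℕ (ℓ ℕ.^ k)) {{ℓ^≢0 k}}
    lem : ∀ r s → (r ℤ.+ s) ℤ.- r ≡ s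
    lem = solve-∀

  !-divides-falling : ∀ b n → ∃[ c ] fromℤ (+ (n !)) * c ≈ falling b n
  !-divides-falling b n = mkℤ_ℓ c c-coherent , mk≈ !*c≈falling
    where
    N : ℕ → ℕ
    N k = n ! ℕ.+ k

    c : ℕ → ℤ
    c k = + (natural (residue b (N k)) (N k) C n)

    !*c : ∀ k → + (n !) ℤ.* c k ≡ fallingℤ (residue b (N k)) n mod-ℓ^ N k
    !*c k = mod-trans
      (≡⇒mod (sym (fallingℤ≡!*C (natural (residue b (N k)) (N k)) n)))
      (mod-falling n (natural-mod (residue b (N k)) (N k)))

    !*c≈falling : ∀ k → + (n !) ℤ.* c k ≡ residue (falling b n) k mod-ℓ^ k
    !*c≈falling k = mod-trans (weaken (ℕ.m≤n+m k (n !)) (!*c k))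
      (mod-trans (mod-falling n (coherent+ b k (n !)))
        (≡⇒mod (sym (residue-falling b n k))))

    c-coherent : ∀ k → c (suc k) ≡ c k mod-ℓ^ k
    c-coherent k = cancel-! n k (mod-trans
      (weaken (ℕ.+-monoʳ-≤ (n !) (ℕ.n≤1+n k)) (!*c (suc k)))
      (mod-trans
        (mod-falling n (subst (λ x → residue b x ≡ residue b (N k) mod-ℓ^ N k)
           (sym (ℕ.+-suc (n !) k)) (coherent b (N k))))
        (mod-sym (!*c k))))

  -- Division by n ! is unambiguous because ℤ_ℓ is torsion-free.
  binomial : ℤ_ℓ → ℕ → ℤ_ℓ
  binomial b n = proj₁ (!-divides-falling b n)

  ----------------------------------------------------------------------
  -- ℤ_ℓ[[T]], a series being its sequence of coefficients.

  PowerSeries : Set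
  PowerSeries = ℕ → ℤ_ℓ

  infix  4 _≋_
  infixl 6 _⊖_
  infixl 7 _⊛_ _·_

  _≋_ : PowerSeries → PowerSeries → Set
  f ≋ g = ∀ n → f n ≈ g n

  constant : ℤ_ℓ → PowerSeries
  constant a zero    = a
  constant a (suc _) = 0#

  _⊖_ _⊛_ : PowerSeries → PowerSeries → PowerSeries
  (f ⊖ g) n = f n - g n
  (f ⊛ g) n = sum {suc n} λ i → f (toℕ i) * g (n ℕ.∸ toℕ i)

  _·_ : ℤ_ℓ → PowerSeries → PowerSeries
  (a · f) n = a * f n

  [1+T]^_ : ℤ_ℓ → PowerSeries
  [1+T]^ b = binomial b

  IsUnit : PowerSeries → Set
  IsUnit u = ∃[ v ] u ⊛ v ≋ constant 1#

  record IsDistinguishedPolynomial (g : PowerSeries) (degree : ℕ) : Set where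
    field
      monic     : g degree ≈ 1#
      vanishing : ∀ n → degree ℕ.< n → g n ≈ 0#
      divisible : ∀ n → n ℕ.< degree → fromℤ (+ ℓ) ∣ₗ g n

  WeierstrassFactorization : PowerSeries → (μ degree : ℕ) → Set
  WeierstrassFactorization f μ degree = ∃[ g ] ∃[ u ]
    IsDistinguishedPolynomial g degree × IsUnit u × f ≋ fromℤ (ℓ^ μ) · (g ⊛ u)

  ----------------------------------------------------------------------
  -- Iwasawa invariants of the bouquet X_t with voltage vector α.

  Admissible : ∀ {t} → Pred (Vector ℤ_ℓ t) 0ℓ
  Admissible α = ¬ (∀ j → fromℤ (+ ℓ) ∣ₗ α j)

  characteristicSeries : ∀ {t} → Vector ℤ_ℓ t → PowerSeries
  characteristicSeries α n =
    sum λ j → (constant (fromℤ (+ 2)) ⊖ [1+T]^ (α j) ⊖ [1+T]^ (- α j)) n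

  -- The invariants are given as the graphs of partial functions: they are
  -- unique, but extracting them from a nonzero series is not constructive.

  IsMu : ∀ {t} → Vector ℤ_ℓ t → ℕ → Set
  IsMu α μ₀ = ∃[ d ] WeierstrassFactorization (characteristicSeries α) μ₀ d

  IsLambda : ∀ {t} → Vector ℤ_ℓ t → ℤ → Set
  IsLambda α λ₀ = ∃[ μ ] ∃[ d ]
    WeierstrassFactorization (characteristicSeries α) μ d × λ₀ ≡ + d ℤ.- + 1

  ----------------------------------------------------------------------
  -- Haar measure on ℤ_ℓᵗ, normalised to total mass 1.

  ℓ^-_ : ℕ → ℚ
  ℓ^- n = (+ 1 ℚ./ (ℓ ℕ.^ n)) {{ℕ.m^n≢0 ℓ n}}

  -- The coset centre + ℓ^depth ℤ_ℓᵗ, one of ℓ^(depth t) disjoint translates.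
  record Ball (t : ℕ) : Set where
    field
      centre : Vector ℤ_ℓ t
      depth  : ℕ

    member : Pred (Vector ℤ_ℓ t) 0ℓ
    member α = ∀ j → fromℤ (ℓ^ depth) ∣ₗ α j - centre j

    volume : ℚ
    volume = ℓ^- (depth ℕ.* t)

  -- nothing stands for the empty set, so finite covers are included.
  Cover : ℕ → Set
  Cover t = ℕ → Maybe (Ball t)

  ⋃ : ∀ {t} → Cover t → Pred (Vector ℤ_ℓ t) 0ℓ
  ⋃ U α = ∃[ i ] Any (λ B → Ball.member B α) (U i)

  partialVolume : ∀ {t} → Cover t → ℕ → ℚ
  partialVolume U n =
    MonoidSum.sum ℚ.+-0-monoid {n} λ i → maybe′ Ball.volume 0ℚ (U (toℕ i))

  OuterMeasure≤ : ∀ {t} → Pred (Vector ℤ_ℓ t) 0ℓ → ℚ → Set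
  OuterMeasure≤ S m = ∀ ε → 0ℚ ℚ.< ε →
    ∃[ U ] S ⊆ ⋃ U × (∀ n → partialVolume U n ℚ.≤ m ℚ.+ ε)

  -- In a space of total mass 1 the outer measures of S and of its
  -- complement add up to at least 1, with equality exactly when S is
  -- measurable.  So this says that S is measurable, of measure m.
  HasHaarMeasure : ∀ {t} → Pred (Vector ℤ_ℓ t) 0ℓ → ℚ → Set
  HasHaarMeasure S m = OuterMeasure≤ S m × OuterMeasure≤ (∁ S) (1ℚ ℚ.- m)

  1-ℓ^-t≢0 : ∀ t .{{_ : ℕ.NonZero t}} → ℚ.NonZero (1ℚ ℚ.- ℓ^- t)
  1-ℓ^-t≢0 (suc t) = ℚ.≢-nonZero λ eq → ℕ.<-irrefl (sym (ℓ^t≡1 (ℓ^-t≡1 eq))) 1<ℓ^t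
    where
    instance
      ℓ^t≢0 : ℕ.NonZero (ℓ ℕ.^ suc t)
      ℓ^t≢0 = ℕ.m^n≢0 ℓ (suc t)
    1<ℓ^t : 1 ℕ.< ℓ ℕ.^ suc t
    1<ℓ^t = ℕ.<-≤-trans 1<ℓ (ℕ.m≤m*n ℓ (ℓ ℕ.^ t) {{ℕ.m^n≢0 ℓ t}})
    ℓ^-t≡1 : 1ℚ ℚ.- ℓ^- suc t ≡ 0ℚ → 1ℚ ≡ ℓ^- suc t
    ℓ^-t≡1 = GroupProperties.x∙y⁻¹≈ε⇒x≈y ℚ.+-0-group 1ℚ (ℓ^- suc t)
    ℓ^t≡1 : 1ℚ ≡ ℓ^- suc t → ℓ ℕ.^ suc t ≡ 1
    ℓ^t≡1 eq = trans (sym (ℕ.*-identityˡ _)) (ℚ.normalize-injective-≃ 1 1 1 (ℓ ℕ.^ suc t) eq)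

  IsProbability : ∀ {t} .{{_ : ℕ.NonZero t}} → ℕ → ℤ → ℚ → Set
  IsProbability {t} μ₀ λ₀ p =
    ∃[ m ] HasHaarMeasure {t} (λ α → Admissible α × IsMu α μ₀ × IsLambda α λ₀) m
         × p ≡ (ℚ.1/ (1ℚ ℚ.- ℓ^- t)) {{1-ℓ^-t≢0 t}} ℚ.* m

module Submission where

-- The coefficients F_0, F_1 of the characteristic series F vanish, F_2 = - (a² + b²),
-- F_3 = a² + b² and 24 F_4 = - 2 (a⁴ + b⁴) - 22 (a² + b²).  So if ℓ ∤ a² + b², the
-- first coefficient of F prime to ℓ is F_2, and μ = 0, λ = 1; if ℓ ∣ a² + b² and α is
-- admissible, then ℓ ∤ a, b and 24 F_4 ≡ 4 a² b², so it is F_4, and μ = 0, λ = 3.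
-- The second case needs a square root r of -1 modulo ℓ, so it does not occur for
-- ℓ ≡ 3 (mod 4), while for ℓ ≡ 1 it consists of the 2 (ℓ - 1) residue classes of
-- (a, ± r a), a ≠ 0.  Explicit covers of both strata and of their complements by
-- residue classes show that their measures are (ℓ - 1)² / ℓ² and 2 (ℓ - 1) / ℓ².

open import Defs
import Algebra.Definitions.RawMagma as RawMagma
open import Algebra.Bundles using (CommutativeMonoid; CommutativeRing)
import Algebra.Properties.CommutativeMonoid.Sum as CommutativeMonoidSum
import Algebra.Properties.CommutativeSemigroup as CommutativeSemigroupProperties
import Algebra.Properties.Semiring.Mult as SemiringMult
open import Data.Fin.Base as Fin using (Fin; zero; suc; toℕ; fromℕ<; punchIn)
open import Data.Fin.Patterns using (0F; 1F)
import Data.Fin.Properties as Fin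
open import Data.Integer.Base as ℤ using (ℤ; +_)
open import Data.Integer.Divisibility.Signed as ℤ∣ using (_∣_; divides)
import Data.Integer.DivMod as ℤ/
import Data.Integer.Properties as ℤ
open import Data.Integer.Tactic.RingSolver using (solve-∀)
open import Data.List.Base as List using (List; []; _∷_; _++_; length; upTo; cartesianProductWith)
open import Data.List.Membership.Propositional using (_∈_; lose)
open import Data.List.Membership.Propositional.Properties
  using (∈-map⁺; ∈-upTo⁺; ∈-cartesianProductWith⁺)
import Data.List.Properties as List
open import Data.List.Relation.Unary.Any as Any using (Any; here; there)
import Data.List.Relation.Unary.Any.Properties as Any
open import Data.Maybe.Base using (just; nothing)
import Data.Maybe.Relation.Unary.Any as Maybe
open import Data.Nat.Base as ℕ using (ℕ; zero; suc; _!; _≤_; _<_; z≤n; s≤s; z<s; s<s)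
open import Data.Nat.Coprimality using (coprime-Bézout)
import Data.Nat.Divisibility as ℕ∣
open import Data.Nat.DivMod using (_%_; m≡m%n+[m/n]*n)
open import Data.Nat.GCD using (module Bézout)
open import Data.Nat.Primality using (Prime; prime⇒nonZero; euclidsLemma)
import Data.Nat.Properties as ℕ
import Data.Nat.Tactic.RingSolver as ℕ-Solver
open import Data.Product.Base using (∃; ∃-syntax; _×_; _,_; proj₁; proj₂)
open import Data.Rational.Base as ℚ using (ℚ; 0ℚ; 1ℚ; _/_; toℚᵘ)
import Data.Rational.Properties as ℚ
open import Data.Rational.Unnormalised.Base as ℚᵘ using (mkℚᵘ; *≡*)
import Data.Rational.Unnormalised.Properties as ℚᵘ
open import Data.Sum.Base as Sum using (_⊎_; inj₁; inj₂; [_,_]′)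
open import Data.Vec.Functional using (Vector; removeAt)
open import Function.Base using (_∘_; case_of_; id)
open import Level using (0ℓ)
open import Relation.Binary.Definitions using (tri<; tri≈; tri>)
open import Relation.Binary.PropositionalEquality
  using (_≡_; _≢_; refl; sym; trans; cong; cong₂; subst; subst₂; module ≡-Reasoning)
open import Relation.Nullary using (¬_; Dec; yes; no; contradiction)
open import Relation.Nullary.Decidable using (dec⇒maybe)
open import Relation.Unary using (Pred; ∁)
import Tactic.RingSolver as RingSolver
open import Tactic.RingSolver.Core.AlmostCommutativeRing
  using (AlmostCommutativeRing; fromCommutativeRing)

open CommutativeMonoidSum ℕ.+-0-commutativeMonoid
  using (sum; sum-cong-≗; sum-remove; sum-replicate-zero; ∑-distrib-+)
open SemiringMult (CommutativeRing.semiring ℚ.+-*-commutativeRing)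
  using (×1-homo-*; ×-assoc-*)
  renaming (_×_ to infixr 8 _×ℚ_)

-- The invariants are given as graphs: a value of λ is attained when some Weierstrass factorization
-- exists, and another value is excluded only by showing that every factorization has the same
-- degree. Both halves see no more of F than the position of its first coefficient prime to ℓ, which
-- is why five coefficients settle everything. The obstacle is existence, since a factorization must
-- be constructed. It comes from two fixed-point equations that contract for different reasons.
-- Inverting a series contracts for the (ℓ,T)-adic topology. Cutting off the tail of F pulls
-- coefficients down from degree d + n to degree n, which loses T-adic precision, so that only the
-- factor ℓ makes it contract. On the measure side, a measure m is asserted through upper bounds for
-- a set and for its complement that add up to 1. Finite covers with exactly these total volumes are
-- therefore enough, and no lower bound for a volume has to be proved.

module PowerSeriesAlgebra (ℓ : ℕ) (ℓ-prime : Prime ℓ) where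
  open ℓ-adic ℓ ℓ-prime
  open CommutativeRing +-*-commutativeRing public
    using (setoid; +-cong; +-congˡ; +-congʳ; *-congˡ; +-identityʳ)
    renaming (refl to ≈-refl; sym to ≈-sym; trans to ≈-trans)
  open import Relation.Binary.Reasoning.Setoid setoid

  infix 4 _≃_[_]
  -- By coherence the single residue at level j decides congruence modulo ℓ^j. Fixing the level
  -- makes it possible to count digits of precision in the contraction arguments; congruence at all
  -- levels is `_≈_`.
  record _≃_[_] (x y : ℤ_ℓ) (j : ℕ) : Set where
    constructor mk≃
    field residue-≃ : residue x j ≡ residue y j mod-ℓ^ j
  open _≃_[_] public

  ≈⇒≃ : ∀ {x y} → x ≈ y → ∀ j → x ≃ y [ j ]
  ≈⇒≃ x≈y j = mk≃ (residue-≈ x≈y j)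

  ≃⇒≈ : ∀ {x y} → (∀ j → x ≃ y [ j ]) → x ≈ y
  ≃⇒≈ x≃y = mk≈ λ j → residue-≃ (x≃y j)

  ≃-refl : ∀ {j x} → x ≃ x [ j ]
  ≃-refl = mk≃ (≡⇒mod refl)

  ≃-sym : ∀ {j x y} → x ≃ y [ j ] → y ≃ x [ j ]
  ≃-sym (mk≃ p) = mk≃ (mod-sym p)

  ≃-trans : ∀ {j x y z} → x ≃ y [ j ] → y ≃ z [ j ] → x ≃ z [ j ]
  ≃-trans (mk≃ p) (mk≃ q) = mk≃ (mod-trans p q)

  ≃-+-cong : ∀ {j x x′ y y′} → x ≃ x′ [ j ] → y ≃ y′ [ j ] → x + y ≃ x′ + y′ [ j ]
  ≃-+-cong (mk≃ p) (mk≃ q) = mk≃ (mod-+ p q)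

  ≃-*-cong : ∀ {j x x′ y y′} → x ≃ x′ [ j ] → y ≃ y′ [ j ] → x * y ≃ x′ * y′ [ j ]
  ≃-*-cong (mk≃ p) (mk≃ q) = mk≃ (mod-* p q)

  ≃-neg-cong : ∀ {j x y} → x ≃ y [ j ] → - x ≃ - y [ j ]
  ≃-neg-cong (mk≃ p) = mk≃ (mod-neg p)

  -- Coefficient n of a product involves only coefficients up to n of its factors. This locality is
  -- the T-adic half of the contraction in `isUnit`.
  ⊛-cong-≃ : ∀ {j f f′ g g′} n →
    (∀ i → i ≤ n → f i ≃ f′ i [ j ]) → (∀ i → i ≤ n → g i ≃ g′ i [ j ]) →
    (f ⊛ g) n ≃ (f′ ⊛ g′) n [ j ]
  ⊛-cong-≃ zero    f≃ g≃ = ≃-+-cong (≃-*-cong (f≃ 0 z≤n) (g≃ 0 z≤n)) ≃-refl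
  ⊛-cong-≃ {f = f} {f′} {g} {g′} (suc n) f≃ g≃ = ≃-+-cong
    (≃-*-cong (f≃ 0 z≤n) (g≃ (suc n) ℕ.≤-refl))
    (⊛-cong-≃ {f = f ∘ suc} {f′ ∘ suc} {g} {g′} n
      (λ i i≤n → f≃ (suc i) (s≤s i≤n)) (λ i i≤n → g≃ i (ℕ.m≤n⇒m≤1+n i≤n)))

  ⊛-cong : ∀ {f f′ g g′} → f ≋ f′ → g ≋ g′ → f ⊛ g ≋ f′ ⊛ g′
  ⊛-cong {f} {f′} {g} {g′} f≋ g≋ n = ≃⇒≈ λ j →
    ⊛-cong-≃ {f = f} {f′} {g} {g′} n (λ i _ → ≈⇒≃ (f≋ i) j) (λ i _ → ≈⇒≃ (g≋ i) j)

  -- The sum unfolds by itself at its first term, a recursion on the left factor. Splitting off the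
  -- last term gives the mirror recursion, and comparing the two yields commutativity.
  ⊛-sucʳ : ∀ f g n → (f ⊛ g) (suc n) ≈ f (suc n) * g 0 + (f ⊛ (g ∘ suc)) n
  ⊛-sucʳ f g zero = pointwise λ k →
    swap (residue (f 0) k) (residue (f 1) k) (residue (g 0) k) (residue (g 1) k)
    where
    swap : ∀ f₀ f₁ g₀ g₁ → f₀ ℤ.* g₁ ℤ.+ (f₁ ℤ.* g₀ ℤ.+ + 0) ≡ f₁ ℤ.* g₀ ℤ.+ (f₀ ℤ.* g₁ ℤ.+ + 0)
    swap = solve-∀
  ⊛-sucʳ f g (suc n) = ≈-trans (+-congˡ (⊛-sucʳ (f ∘ suc) g n)) (pointwise λ k →
    swap (residue (f 0 * g (suc (suc n))) k) (residue (f (suc (suc n)) * g 0) k)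
         (residue (((f ∘ suc) ⊛ (g ∘ suc)) n) k))
    where
    swap : ∀ x y z → x ℤ.+ (y ℤ.+ z) ≡ y ℤ.+ (x ℤ.+ z)
    swap = solve-∀

  ⊛-comm : ∀ f g → f ⊛ g ≋ g ⊛ f
  ⊛-comm f g zero    = pointwise λ k → cong (ℤ._+ + 0) (ℤ.*-comm (residue (f 0) k) _)
  ⊛-comm f g (suc n) = ≈-trans
    (+-cong (pointwise λ k → ℤ.*-comm (residue (f 0) k) _) (⊛-comm (f ∘ suc) g n))
    (≈-sym (⊛-sucʳ g f n))

  -- The combination a f + f′ is the shape that the tail of a product takes in the proof of
  -- associativity, and also that of the decomposition ℓ P + T^d V below.
  ⊛-linearˡ : ∀ a f f′ g n →
    ((λ i → a * f i + f′ i) ⊛ g) n ≈ a * (f ⊛ g) n + (f′ ⊛ g) n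
  ⊛-linearˡ a f f′ g zero = pointwise λ k →
    lem (residue a k) (residue (f 0) k) (residue (f′ 0) k) (residue (g 0) k)
    where
    lem : ∀ a x y z → (a ℤ.* x ℤ.+ y) ℤ.* z ℤ.+ + 0
                    ≡ a ℤ.* (x ℤ.* z ℤ.+ + 0) ℤ.+ (y ℤ.* z ℤ.+ + 0)
    lem = solve-∀
  ⊛-linearˡ a f f′ g (suc n) = ≈-trans (+-congˡ (⊛-linearˡ a (f ∘ suc) (f′ ∘ suc) g n))
    (pointwise λ k → lem (residue a k) (residue (f 0) k) (residue (f′ 0) k) (residue (g (suc n)) k)
      (residue (((f ∘ suc) ⊛ g) n) k) (residue (((f′ ∘ suc) ⊛ g) n) k))
    where
    lem : ∀ a x y z s t → (a ℤ.* x ℤ.+ y) ℤ.* z ℤ.+ (a ℤ.* s ℤ.+ t)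
                        ≡ a ℤ.* (x ℤ.* z ℤ.+ s) ℤ.+ (y ℤ.* z ℤ.+ t)
    lem = solve-∀

  ⊛-zeroˡ : ∀ g n → ((λ _ → 0#) ⊛ g) n ≈ 0#
  ⊛-zeroˡ g zero    = pointwise λ _ → refl
  ⊛-zeroˡ g (suc n) = ≈-trans (+-congˡ (⊛-zeroˡ g n)) (pointwise λ _ → refl)

  ⊛-identityˡ : ∀ g → constant 1# ⊛ g ≋ g
  ⊛-identityˡ g zero    = pointwise λ k → trans (ℤ.+-identityʳ _) (ℤ.*-identityˡ _)
  ⊛-identityˡ g (suc n) = ≈-trans (+-congˡ (⊛-zeroˡ g n))
    (pointwise λ k → trans (ℤ.+-identityʳ _) (ℤ.*-identityˡ _))

  ⊛-assoc : ∀ f g h → (f ⊛ g) ⊛ h ≋ f ⊛ (g ⊛ h)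
  ⊛-assoc f g h zero = pointwise λ k →
    lem (residue (f 0) k) (residue (g 0) k) (residue (h 0) k)
    where
    lem : ∀ x y z → (x ℤ.* y ℤ.+ + 0) ℤ.* z ℤ.+ + 0 ≡ x ℤ.* (y ℤ.* z ℤ.+ + 0) ℤ.+ + 0
    lem = solve-∀
  ⊛-assoc f g h (suc n) = begin
    (f ⊛ g) 0 * h (suc n) + ((λ i → f 0 * g (suc i) + ((f ∘ suc) ⊛ g) i) ⊛ h) n
      ≈⟨ +-congˡ (⊛-linearˡ (f 0) (g ∘ suc) ((f ∘ suc) ⊛ g) h n) ⟩
    (f ⊛ g) 0 * h (suc n) + (f 0 * ((g ∘ suc) ⊛ h) n + (((f ∘ suc) ⊛ g) ⊛ h) n)
      ≈⟨ +-congˡ (+-congˡ (⊛-assoc (f ∘ suc) g h n)) ⟩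
    (f ⊛ g) 0 * h (suc n) + (f 0 * ((g ∘ suc) ⊛ h) n + ((f ∘ suc) ⊛ (g ⊛ h)) n)
      ≈⟨ (pointwise λ k → lem (residue (f 0) k) (residue (g 0) k) (residue (h (suc n)) k)
           (residue (((g ∘ suc) ⊛ h) n) k) (residue (((f ∘ suc) ⊛ (g ⊛ h)) n) k)) ⟩
    f 0 * (g 0 * h (suc n) + ((g ∘ suc) ⊛ h) n) + ((f ∘ suc) ⊛ (g ⊛ h)) n ∎
    where
    lem : ∀ x y z s t → (x ℤ.* y ℤ.+ + 0) ℤ.* z ℤ.+ (x ℤ.* s ℤ.+ t)
                      ≡ x ℤ.* (y ℤ.* z ℤ.+ s) ℤ.+ t
    lem = solve-∀

  ⊛-commutativeMonoid : CommutativeMonoid 0ℓ 0ℓ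
  ⊛-commutativeMonoid = record
    { Carrier = PowerSeries ; _≈_ = _≋_ ; _∙_ = _⊛_ ; ε = constant 1#
    ; isCommutativeMonoid = record
      { isMonoid = record
        { isSemigroup = record
          { isMagma = record
            { isEquivalence = record
              { refl  = λ n → ≈-refl
              ; sym   = λ p n → ≈-sym (p n)
              ; trans = λ p q n → ≈-trans (p n) (q n)
              }
            ; ∙-cong = λ {f} {f′} {g} {g′} → ⊛-cong {f} {f′} {g} {g′}
            }
          ; assoc = ⊛-assoc
          }
        ; identity = ⊛-identityˡ , λ f n → ≈-trans (⊛-comm f (constant 1#) n) (⊛-identityˡ f n)
        }
      ; comm = ⊛-comm
      }
    }

-- Weierstrass preparation over ℤ_ℓ and uniqueness of the degree.

module Weierstrass (ℓ : ℕ) (ℓ-prime : Prime ℓ) where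
  open ℓ-adic ℓ ℓ-prime
  open PowerSeriesAlgebra ℓ ℓ-prime
  open RawMagma *-rawMagma using (_,_)

  ℓ^1≡ℓ : ℓ^ 1 ≡ + ℓ
  ℓ^1≡ℓ = cong +_ (ℕ.*-identityʳ ℓ)

  mod⇒∣ : ∀ {a b} → a ≡ b mod-ℓ^ 1 → + ℓ ∣ a ℤ.- b
  mod⇒∣ {a} {b} (mk≡mod p) = subst (_∣ a ℤ.- b) ℓ^1≡ℓ p

  ∣⇒mod : ∀ {a b} → + ℓ ∣ a ℤ.- b → a ≡ b mod-ℓ^ 1
  ∣⇒mod {a} {b} p = mk≡mod (subst (_∣ a ℤ.- b) (sym ℓ^1≡ℓ) p)

  ≃0⇒∣ : ∀ {x} → x ≃ 0# [ 1 ] → + ℓ ∣ residue x 1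
  ≃0⇒∣ {x} (mk≃ p) = subst (+ ℓ ∣_) (ℤ.+-identityʳ (residue x 1)) (mod⇒∣ p)

  ∣⇒≃0 : ∀ {x} → + ℓ ∣ residue x 1 → x ≃ 0# [ 1 ]
  ∣⇒≃0 {x} p = mk≃ (∣⇒mod (subst (+ ℓ ∣_) (sym (ℤ.+-identityʳ (residue x 1))) p))

  -- Dividing by ℓ^k loses k digits, so the quotient modulo ℓ^n is computed from the residue at
  -- level n + k.
  ≃⇒∣ₗ : ∀ {k x y} → x ≃ y [ k ] → fromℤ (ℓ^ k) ∣ₗ x - y
  ≃⇒∣ₗ {k} {x} {y} (mk≃ x≡y) = mkℤ_ℓ quotient quotient-coherent , mk≈ quotient*ℓᵏ≡
    where
    instance
      ℓᵏ≢0 : ℤ.NonZero (ℓ^ k)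
      ℓᵏ≢0 = ℓ^≢0 k
    d : ℕ → ℤ
    d n = residue (x - y) (n ℕ.+ k)
    ℓᵏ∣d : ∀ n → ℓ^ k ∣ d n
    ℓᵏ∣d n = ℓ^n∣a-b (mod-trans (coherent+ x k n) (mod-trans x≡y (mod-sym (coherent+ y k n))))
    quotient : ℕ → ℤ
    quotient n = _∣_.quotient (ℓᵏ∣d n)
    d≡ : ∀ n → quotient n ℤ.* ℓ^ k ≡ d n
    d≡ n = sym (_∣_.equality (ℓᵏ∣d n))
    quotient-coherent : ∀ n → quotient (suc n) ≡ quotient n mod-ℓ^ n
    quotient-coherent n = mk≡mod (ℤ∣.*-cancelʳ-∣ (ℓ^ k) (subst₂ _∣_
      (trans (cong +_ (ℕ.^-distribˡ-+-* ℓ n k)) (ℤ.pos-* (ℓ ℕ.^ n) (ℓ ℕ.^ k)))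
      (trans (cong₂ ℤ._-_ (sym (d≡ (suc n))) (sym (d≡ n))) (lem (quotient (suc n)) (quotient n) (ℓ^ k)))
      (ℓ^n∣a-b (coherent (x - y) (n ℕ.+ k)))))
      where
      lem : ∀ a b c → a ℤ.* c ℤ.- b ℤ.* c ≡ (a ℤ.- b) ℤ.* c
      lem = solve-∀
    quotient*ℓᵏ≡ : ∀ n → quotient n ℤ.* ℓ^ k ≡ residue (x - y) n mod-ℓ^ n
    quotient*ℓᵏ≡ n = mod-trans (≡⇒mod (trans (d≡ n) (cong (residue (x - y)) (ℕ.+-comm n k))))
      (coherent+ (x - y) n k)

  ∣ₗ⇒≃ : ∀ {k x y} → fromℤ (ℓ^ k) ∣ₗ x - y → x ≃ y [ k ]
  ∣ₗ⇒≃ {k} {x} {y} (q , mk≈ qℓᵏ≡) = mk≃ (mk≡mod (subst (ℓ^ k ∣_)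
    (lem (residue q k ℤ.* ℓ^ k) (residue (x - y) k))
    (ℤ∣.∣m∣n⇒∣m-n (ℤ∣.∣n⇒∣m*n (residue q k) ℤ∣.∣-refl) (ℓ^n∣a-b (qℓᵏ≡ k)))))
    where
    lem : ∀ a b → a ℤ.- (a ℤ.- b) ≡ b
    lem = solve-∀

  x-0≈x : ∀ {x} → x - 0# ≈ x
  x-0≈x {x} = pointwise λ n → ℤ.+-identityʳ (residue x n)

  ℓ^1∣ₗ⇒ℓ∣ₗ : ∀ {x} → fromℤ (ℓ^ 1) ∣ₗ x - 0# → fromℤ (+ ℓ) ∣ₗ x
  ℓ^1∣ₗ⇒ℓ∣ₗ (q , qℓ≈) =
    q , ≈-trans (*-congˡ {x = q} (pointwise λ _ → sym ℓ^1≡ℓ)) (≈-trans qℓ≈ x-0≈x)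

  ≃0⇒ℓ∣ₗ : ∀ {x} → x ≃ 0# [ 1 ] → fromℤ (+ ℓ) ∣ₗ x
  ≃0⇒ℓ∣ₗ x≃0 = ℓ^1∣ₗ⇒ℓ∣ₗ (≃⇒∣ₗ x≃0)

  ℓ∣ₗ⇒≃0 : ∀ {x} → fromℤ (+ ℓ) ∣ₗ x → x ≃ 0# [ 1 ]
  ℓ∣ₗ⇒≃0 {x} (q , qℓ≈x) = ∣ₗ⇒≃ (q ,
    ≈-trans (*-congˡ {x = q} (pointwise λ _ → ℓ^1≡ℓ)) (≈-trans qℓ≈x (≈-sym x-0≈x)))

  ℓ≃0 : fromℤ (+ ℓ) ≃ 0# [ 1 ]
  ℓ≃0 = ∣⇒≃0 ℤ∣.∣-refl

  1≄0 : ¬ 1# ≃ 0# [ 1 ]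
  1≄0 1≃0 = ℕ.<⇒≱ 1<ℓ (ℕ∣.∣⇒≤ (ℤ∣.∣⇒∣ᵤ (≃0⇒∣ 1≃0)))

  ≃-trivial : ∀ {x y} → x ≃ y [ 0 ]
  ≃-trivial {x} {y} = mk≃ (mk≡mod (divides a (sym (ℤ.*-identityʳ a))))
    where
    a : ℤ
    a = residue x 0 ℤ.- residue y 0

  ≃-zeroˡ : ∀ {x j} y → x ≃ 0# [ j ] → x * y ≃ 0# [ j ]
  ≃-zeroˡ y x≃0 = ≃-trans (≃-*-cong x≃0 ≃-refl) (≈⇒≃ (pointwise λ _ → refl) _)

  -- A factor divisible by ℓ gains one digit of precision; this is the ℓ-adic source of every
  -- contraction below.
  *-≃-lift : ∀ {w x y j} → w ≃ 0# [ 1 ] → x ≃ y [ j ] → w * x ≃ w * y [ suc j ]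
  *-≃-lift {w} {x} {y} {j} w≃0 (mk≃ x≡y) = mk≃ (mk≡mod (subst₂ _∣_
    (sym (ℤ.pos-* ℓ (ℓ ℕ.^ j))) (lem (residue w (suc j)) (residue x (suc j)) (residue y (suc j)))
    (∣-* ℓ∣w (ℓ^n∣a-b x≡y′))))
    where
    lem : ∀ w x y → w ℤ.* (x ℤ.- y) ≡ w ℤ.* x ℤ.- w ℤ.* y
    lem = solve-∀
    ∣-* : ∀ {a b c d} → a ∣ b → c ∣ d → a ℤ.* c ∣ b ℤ.* d
    ∣-* {a} {b} {c} {d} p q = ℤ∣.∣-trans (ℤ∣.*-monoˡ-∣ c p) (ℤ∣.*-monoʳ-∣ b q)
    x≡y′ : residue x (suc j) ≡ residue y (suc j) mod-ℓ^ j
    x≡y′ = mod-trans (coherent x j) (mod-trans x≡y (mod-sym (coherent y j)))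
    ℓ∣w : + ℓ ∣ residue w (suc j)
    ℓ∣w = subst (+ ℓ ∣_) (ℤ.+-identityʳ (residue w (suc j))) (mod⇒∣ (mod-trans
      (subst (λ n → residue w n ≡ residue w 1 mod-ℓ^ 1) (ℕ.+-comm j 1) (coherent+ w 1 j))
      (residue-≃ w≃0)))

  -- The Banach fixed point theorem for power series.  The weight c i of the
  -- coefficient of Tⁱ allows both the (ℓ,T)-adic and the ℓ-adic topology.
  module FixedPoint (c : ℕ → ℕ) where

    -- For `c i = i` this is congruence modulo the ideal power (ℓ,T)^n, for `c i = 0` it is
    -- congruence modulo ℓ^n.
    Agree : ℕ → PowerSeries → PowerSeries → Set
    Agree n f g = ∀ i j → c i ℕ.+ j ≤ n → f i ≃ g i [ j ]

    module _ (Φ : PowerSeries → PowerSeries)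
             (contraction : ∀ {n f g} → Agree n f g → Agree (suc n) (Φ f) (Φ g)) where

      iterate : ℕ → PowerSeries
      iterate zero    = λ _ → 0#
      iterate (suc n) = Φ (iterate n)

      iterate-step : ∀ n → Agree n (iterate (suc n)) (iterate n)
      iterate-step zero i j c+j≤0
        rewrite ℕ.n≤0⇒n≡0 (ℕ.≤-trans (ℕ.m≤n+m j (c i)) c+j≤0) = ≃-trivial
      iterate-step (suc n) = contraction (iterate-step n)

      iterate-agree : ∀ m k → Agree m (iterate (k ℕ.+ m)) (iterate m)
      iterate-agree m zero    i j _ = ≃-refl
      iterate-agree m (suc k) i j c+j≤m = ≃-trans
        (iterate-step (k ℕ.+ m) i j (ℕ.≤-trans c+j≤m (ℕ.m≤n+m m k)))
        (iterate-agree m k i j c+j≤m)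

      -- Modulo ℓ^j, coefficient i no longer changes from iterate c i + j on, so its residue is read
      -- off there.
      fixedPoint : PowerSeries
      fixedPoint i = mkℤ_ℓ (λ j → residue (iterate (c i ℕ.+ j) i) j) λ j →
        mod-trans (coherent (iterate (c i ℕ.+ suc j) i) j)
          (subst (λ n → residue (iterate n i) j ≡ residue (iterate (c i ℕ.+ j) i) j mod-ℓ^ j)
            (sym (ℕ.+-suc (c i) j))
            (residue-≃ (iterate-step (c i ℕ.+ j) i j ℕ.≤-refl)))

      fixedPoint-agree : ∀ n → Agree n (iterate n) fixedPoint
      fixedPoint-agree n i j c+j≤n = mk≃ (residue-≃
        (subst (λ m → iterate m i ≃ iterate (c i ℕ.+ j) i [ j ]) (ℕ.m∸n+n≡m c+j≤n)
          (iterate-agree (c i ℕ.+ j) (n ℕ.∸ (c i ℕ.+ j)) i j ℕ.≤-refl)))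

      fixedPoint-fixed : fixedPoint ≋ Φ fixedPoint
      fixedPoint-fixed i = ≃⇒≈ λ j → ≃-trans
        (≃-sym (fixedPoint-agree (suc (c i ℕ.+ j)) i j (ℕ.n≤1+n _)))
        (contraction (fixedPoint-agree (c i ℕ.+ j)) i j (ℕ.n≤1+n _))

  inverse-modℓ-ℕ : ∀ m → ¬ ℓ ℕ∣.∣ m → ∃[ y ] + ℓ ∣ + m ℤ.* y ℤ.- + 1
  inverse-modℓ-ℕ m ℓ∤m with coprime-Bézout (coprime-ℓ ℓ∤m)
  ... | Bézout.+- x y 1+ym≡xℓ = ℤ.- + y , divides (ℤ.- + x)
    (trans (lem (+ m) (+ y)) (trans (cong ℤ.-_ (trans (cong (λ a → + 1 ℤ.+ a) (sym (ℤ.pos-* y m)))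
      (trans (cong +_ 1+ym≡xℓ) (ℤ.pos-* x ℓ)))) (ℤ.neg-distribˡ-* (+ x) (+ ℓ))))
    where
    lem : ∀ m y → m ℤ.* (ℤ.- y) ℤ.- + 1 ≡ ℤ.- (+ 1 ℤ.+ y ℤ.* m)
    lem = solve-∀
  ... | Bézout.-+ x y 1+xℓ≡ym = + y , divides (+ x)
    (trans (cong (ℤ._- + 1) (trans (sym (ℤ.pos-* m y))
      (trans (cong +_ (trans (ℕ.*-comm m y) (sym 1+xℓ≡ym)))
      (cong (λ a → + 1 ℤ.+ a) (ℤ.pos-* x ℓ))))) (lem (+ x ℤ.* + ℓ)))
    where
    lem : ∀ a → + 1 ℤ.+ a ℤ.- + 1 ≡ a
    lem = solve-∀

  inverse-modℓ : ∀ a → ¬ + ℓ ∣ a → ∃[ y ] + ℓ ∣ a ℤ.* y ℤ.- + 1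
  inverse-modℓ a ℓ∤a with inverse-modℓ-ℕ (ℤ.∣ a ∣) (λ ℓ∣∣a∣ → ℓ∤a (ℤ∣.∣ᵤ⇒∣ ℓ∣∣a∣)) | ℤ.+∣i∣≡i⊎+∣i∣≡-i a
  ... | y , ℓ∣ | inj₁ eq = y , subst (λ b → + ℓ ∣ b ℤ.* y ℤ.- + 1) eq ℓ∣
  ... | y , ℓ∣ | inj₂ eq = ℤ.- y , subst (λ b → + ℓ ∣ b ℤ.- + 1)
    (trans (cong (ℤ._* y) eq) (lem a y)) ℓ∣
    where
    lem : ∀ a y → ℤ.- a ℤ.* y ≡ a ℤ.* (ℤ.- y)
    lem = solve-∀

  ·-⊛ : ∀ a f g → (a · f) ⊛ g ≋ a · (f ⊛ g)
  ·-⊛ a f g n = ≈-trans (⊛-cong {f = a · f} {λ i → a * f i + 0#} {g} {g}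
      (λ i → ≈-sym (+-identityʳ (a * f i))) (λ _ → ≈-refl) n)
    (≈-trans (⊛-linearˡ a f (λ _ → 0#) g n)
      (≈-trans (+-congˡ (⊛-zeroˡ g n)) (+-identityʳ (a * (f ⊛ g) n))))

  -- An inverse y of the constant term modulo ℓ is enough: then 1 - y u lies in (ℓ,T), the geometric
  -- series v of its powers converges, and y v inverts u. The ℓ-adic correction of y is thus left to
  -- the same limit as the inversion in T.
  isUnit : ∀ u → ¬ u 0 ≃ 0# [ 1 ] → IsUnit u
  isUnit u u₀≄0 = y · v , λ n → ≈-trans (⊛-comm u (y · v) n)
    (≈-trans (·-⊛ y v u n) (≈-trans (*-congˡ {x = y} (⊛-comm v u n)) (y*[u⊛v]≈1 n)))
    where
    open FixedPoint (λ i → i)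

    inv : ∃[ a ] + ℓ ∣ residue (u 0) 1 ℤ.* a ℤ.- + 1
    inv = inverse-modℓ (residue (u 0) 1) (u₀≄0 ∘ ∣⇒≃0)

    y : ℤ_ℓ
    y = fromℤ (proj₁ inv)

    -- w = 1 - y u lies in the ideal (ℓ, T), so v = 1 + w v has a solution.
    w : PowerSeries
    w i = - y * u i + constant 1# i

    w₀≃0 : w 0 ≃ 0# [ 1 ]
    w₀≃0 = ∣⇒≃0 (subst (+ ℓ ∣_) (lem (residue (u 0) 1) (proj₁ inv)) (ℤ∣.∣m⇒∣-m (proj₂ inv)))
      where
      lem : ∀ u y → ℤ.- (u ℤ.* y ℤ.- + 1) ≡ ℤ.- y ℤ.* u ℤ.+ + 1
      lem = solve-∀

    Φ : PowerSeries → PowerSeries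
    Φ v n = constant 1# n + (w ⊛ v) n

    w₀*-cong : ∀ {n f g} → Agree n f g → ∀ i j → i ℕ.+ j ≤ suc n → w 0 * f i ≃ w 0 * g i [ j ]
    w₀*-cong f~g i zero    _       = ≃-trivial
    w₀*-cong {n} f~g i (suc j) i+1+j≤1+n = *-≃-lift w₀≃0
      (f~g i j (ℕ.s≤s⁻¹ (subst (_≤ suc n) (ℕ.+-suc i j) i+1+j≤1+n)))

    contraction : ∀ {n f g} → Agree n f g → Agree (suc n) (Φ f) (Φ g)
    contraction f~g zero j j≤1+n =
      ≃-+-cong ≃-refl (≃-+-cong (w₀*-cong f~g 0 j j≤1+n) ≃-refl)
    contraction {n} {f} {g} f~g (suc i) j 1+i+j≤1+n = ≃-+-cong ≃-refl (≃-+-cong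
      (w₀*-cong f~g (suc i) j 1+i+j≤1+n)
      -- The terms of w beyond the constant one reach only coefficients of index at most i for an
      -- output of index i + 1: here the gain is one degree in T rather than one power of ℓ.
      (⊛-cong-≃ {f = w ∘ suc} {w ∘ suc} {f} {g} i (λ _ _ → ≃-refl) λ i′ i′≤i →
        f~g i′ j (ℕ.≤-trans (ℕ.+-monoˡ-≤ j i′≤i) (ℕ.s≤s⁻¹ 1+i+j≤1+n))))

    v : PowerSeries
    v = fixedPoint Φ contraction

    v≈ : ∀ n → v n ≈ constant 1# n + (- y * (u ⊛ v) n + v n)
    v≈ n = ≈-trans (fixedPoint-fixed Φ contraction n) (+-congˡ
      (≈-trans (⊛-linearˡ (- y) u (constant 1#) v n) (+-congˡ (⊛-identityˡ v n))))

    y*[u⊛v]≈1 : ∀ n → y * (u ⊛ v) n ≈ constant 1# n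
    y*[u⊛v]≈1 n = begin
      y * x
        ≈⟨ (pointwise λ k → lem₁ (residue y k) (residue x k) (residue (v n) k)) ⟩
      v n + (y * x - v n)
        ≈⟨ +-congʳ (v≈ n) ⟩
      constant 1# n + (- y * x + v n) + (y * x - v n)
        ≈⟨ (pointwise λ k → lem₂ (residue y k) (residue x k) (residue (v n) k)
             (residue (constant 1# n) k)) ⟩
      constant 1# n ∎
      where
      open import Relation.Binary.Reasoning.Setoid setoid
      x : ℤ_ℓ
      x = (u ⊛ v) n
      lem₁ : ∀ y x v → y ℤ.* x ≡ v ℤ.+ (y ℤ.* x ℤ.- v)
      lem₁ = solve-∀
      lem₂ : ∀ y x v c → (c ℤ.+ (ℤ.- y ℤ.* x ℤ.+ v)) ℤ.+ (y ℤ.* x ℤ.- v) ≡ c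
      lem₂ = solve-∀

  -- Multiplication by T^d, defined by recursion so that it unfolds together with `⊛`.
  shift : ℕ → PowerSeries → PowerSeries
  shift zero    f n       = f n
  shift (suc d) f zero    = 0#
  shift (suc d) f (suc n) = shift d f n

  shift-+ : ∀ d f n → shift d f (d ℕ.+ n) ≡ f n
  shift-+ zero    f n = refl
  shift-+ (suc d) f n = shift-+ d f n

  shift-d : ∀ d f → shift d f d ≡ f 0
  shift-d zero    f = refl
  shift-d (suc d) f = shift-d d f

  shift-< : ∀ {d n} f → n < d → shift d f n ≡ 0#
  shift-< {suc d} {zero}  f _         = refl
  shift-< {suc d} {suc n} f (s≤s n<d) = shift-< f n<d

  shift-cong : ∀ d {f g} → f ≋ g → shift d f ≋ shift d g
  shift-cong zero    f≋g n       = f≋g n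
  shift-cong (suc d) f≋g zero    = ≈-refl
  shift-cong (suc d) f≋g (suc n) = shift-cong d f≋g n

  shift-⊛ : ∀ d f g → shift d f ⊛ g ≋ shift d (f ⊛ g)
  shift-⊛ zero    f g n       = ≈-refl
  shift-⊛ (suc d) f g zero    = pointwise λ _ → refl
  shift-⊛ (suc d) f g (suc n) = ≈-trans (pointwise λ _ → ℤ.+-identityˡ _) (shift-⊛ d f g n)

  -- The low coefficients, each divided by ℓ, form P, and the remaining ones form T^d V. This is the
  -- starting point of Manin's proof of the preparation theorem.
  split : ∀ d (F : PowerSeries) → (∀ n → n < d → F n ≃ 0# [ 1 ]) →
    ∃ λ (P : PowerSeries) → ∀ n → F n ≈ fromℤ (+ ℓ) * P n + shift d (λ m → F (d ℕ.+ m)) n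
  split zero    F _   = (λ _ → 0#) , λ n → pointwise λ k →
    sym (trans (cong (ℤ._+ residue (F n) k) (ℤ.*-zeroʳ (+ ℓ))) (ℤ.+-identityˡ _))
  split (suc d) F F≃0
    = cons (≃0⇒ℓ∣ₗ (F≃0 0 z<s)) (split d (F ∘ suc) (λ n n<d → F≃0 (suc n) (s<s n<d)))
    where
    cons : fromℤ (+ ℓ) ∣ₗ F 0 →
      (∃ λ (P : PowerSeries) → ∀ n → F (suc n) ≈ fromℤ (+ ℓ) * P n + shift d (λ m → F (suc d ℕ.+ m)) n) →
      ∃ λ (P : PowerSeries) → ∀ n → F n ≈ fromℤ (+ ℓ) * P n + shift (suc d) (λ m → F (suc d ℕ.+ m)) n
    cons (P₀ , P₀ℓ≈F₀) (P , F≈) =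
      (λ { zero → P₀ ; (suc n) → P n }) ,
      λ { zero → ≈-trans (≈-sym P₀ℓ≈F₀)
                   (pointwise λ k → trans (ℤ.*-comm (residue P₀ k) (+ ℓ)) (sym (ℤ.+-identityʳ _)))
        ; (suc n) → F≈ n }

  -- For F = ℓ P + Tᵈ V and V Y = 1 one has F Y = ℓ W + Tᵈ with W = P Y, and the
  -- equation for z says that all coefficients of F Y z beyond Tᵈ vanish.
  module _ (d : ℕ) {F P V Y z Z : PowerSeries}
    (F≈ : ∀ n → F n ≈ fromℤ (+ ℓ) * P n + shift d V n)
    (VY≋1 : V ⊛ Y ≋ constant 1#)
    (z≈ : ∀ n → z n ≈ constant 1# n - fromℤ (+ ℓ) * ((P ⊛ Y) ⊛ z) (d ℕ.+ n))
    (zZ≋1 : z ⊛ Z ≋ constant 1#)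
    where
    private
      open CommutativeMonoid ⊛-commutativeMonoid
        using (commutativeSemigroup; ∙-cong; ∙-congˡ; ∙-congʳ; identityʳ)
        renaming (sym to ≋-sym; trans to ≋-trans; setoid to ≋-setoid)
      open CommutativeSemigroupProperties commutativeSemigroup using (interchange)
      open import Relation.Binary.Reasoning.Setoid ≋-setoid

      l : ℤ_ℓ
      l = fromℤ (+ ℓ)
      one W g u : PowerSeries
      one = constant 1#
      W = P ⊛ Y
      g n = l * (W ⊛ z) n + shift d z n
      -- Since F Y z = g is to hold, the unit has to be the inverse of Y z, that is, Z V.
      u = Z ⊛ V

      -- From degree d on, the equation for z cancels ℓ W z against T^d z up to the constant 1. So
      -- the leading coefficient and the vanishing of all later ones come from one identity.
      g≈ : ∀ n → g (d ℕ.+ n) ≈ constant 1# n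
      g≈ n = ≈-trans (+-congˡ (subst (λ x → x ≈ z n) (sym (shift-+ d z n)) ≈-refl))
        (≈-trans (+-congˡ (z≈ n)) (pointwise λ k →
          lem (residue (l * (W ⊛ z) (d ℕ.+ n)) k) (residue (constant 1# n) k)))
        where
        lem : ∀ a b → a ℤ.+ (b ℤ.- a) ≡ b
        lem = solve-∀

      g≃0 : ∀ n → n < d → g n ≃ 0# [ 1 ]
      g≃0 n n<d = subst (λ x → l * (W ⊛ z) n + x ≃ 0# [ 1 ]) (sym (shift-< z n<d))
        (≃-trans (≃-+-cong (≃-zeroˡ ((W ⊛ z) n) ℓ≃0) ≃-refl) (≈⇒≃ (pointwise λ _ → refl) 1))

      beyond : ∀ m → 0 < m → g (d ℕ.+ m) ≈ 0#
      beyond (suc m) _ = g≈ (suc m)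

      distinguished : IsDistinguishedPolynomial g d
      distinguished = record
        { monic     = subst (λ n → g n ≈ 1#) (ℕ.+-identityʳ d) (g≈ 0)
        ; vanishing = λ n d<n → subst (λ m → g m ≈ 0#) (ℕ.m+[n∸m]≡n (ℕ.<⇒≤ d<n))
            (beyond (n ℕ.∸ d) (ℕ.m<n⇒0<n∸m d<n))
        ; divisible = λ n n<d → ≃0⇒ℓ∣ₗ (g≃0 n n<d)
        }

      ZVYz≋1 : (Z ⊛ V) ⊛ (Y ⊛ z) ≋ one
      ZVYz≋1 = begin
        (Z ⊛ V) ⊛ (Y ⊛ z) ≈⟨ ∙-congˡ {Z ⊛ V} (⊛-comm Y z) ⟩
        (Z ⊛ V) ⊛ (z ⊛ Y) ≈⟨ interchange Z V z Y ⟩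
        (Z ⊛ z) ⊛ (V ⊛ Y) ≈⟨ ∙-cong {Z ⊛ z} {z ⊛ Z} {V ⊛ Y} {one} (⊛-comm Z z) VY≋1 ⟩
        (z ⊛ Z) ⊛ one     ≈⟨ identityʳ (z ⊛ Z) ⟩
        z ⊛ Z             ≈⟨ zZ≋1 ⟩
        one               ∎

      FY≋ : F ⊛ Y ≋ λ n → l * W n + shift d one n
      FY≋ n = ≈-trans
        (⊛-cong {F} {λ i → l * P i + shift d V i} {Y} {Y} F≈ (λ _ → ≈-refl) n)
        (≈-trans (⊛-linearˡ l P (shift d V) Y n)
          (+-congˡ (≈-trans (shift-⊛ d V Y n) (shift-cong d VY≋1 n))))

      FYz≋g : (F ⊛ Y) ⊛ z ≋ g
      FYz≋g n = ≈-trans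
        (⊛-cong {F ⊛ Y} {λ i → l * W i + shift d one i} {z} {z} FY≋ (λ _ → ≈-refl) n)
        (≈-trans (⊛-linearˡ l W (shift d one) z n)
          (+-congˡ (≈-trans (shift-⊛ d one z n) (shift-cong d (⊛-identityˡ z) n))))

      gu≋F : g ⊛ u ≋ F
      gu≋F = begin
        g ⊛ u               ≈⟨ ∙-congʳ {u} {g} (≋-sym FYz≋g) ⟩
        ((F ⊛ Y) ⊛ z) ⊛ u   ≈⟨ ∙-congʳ {u} {(F ⊛ Y) ⊛ z} (⊛-assoc F Y z) ⟩
        (F ⊛ (Y ⊛ z)) ⊛ u   ≈⟨ ⊛-assoc F (Y ⊛ z) u ⟩
        F ⊛ ((Y ⊛ z) ⊛ u)   ≈⟨ ∙-congˡ {F} (≋-trans (⊛-comm (Y ⊛ z) u) ZVYz≋1) ⟩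
        F ⊛ one             ≈⟨ identityʳ F ⟩
        F                   ∎

    weierstrassFactorization : WeierstrassFactorization F 0 d
    weierstrassFactorization = g , u , distinguished , (Y ⊛ z , ZVYz≋1) ,
      λ n → ≈-trans (≈-sym (gu≋F n)) (pointwise λ _ → sym (ℤ.*-identityˡ _))

  module _ (d : ℕ) (W : PowerSeries) where
    private
      -- Coefficient n of `Φ z` depends on coefficients of z up to d + n, so no weight growing with
      -- the index would be respected; the factor ℓ alone contracts.
      open FixedPoint (λ _ → 0)

      Φ : PowerSeries → PowerSeries
      Φ z n = constant 1# n - fromℤ (+ ℓ) * (W ⊛ z) (d ℕ.+ n)

      contraction : ∀ {n f g} → Agree n f g → Agree (suc n) (Φ f) (Φ g)
      contraction f~g i zero _ = ≃-trivial
      contraction {n} {f} {g} f~g i (suc j) (s≤s j≤n) = ≃-+-cong ≃-refl (≃-neg-cong (*-≃-lift ℓ≃0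
        (⊛-cong-≃ {f = W} {W} {f} {g} (d ℕ.+ i) (λ _ _ → ≃-refl) λ i′ _ → f~g i′ j j≤n)))

    -- With τ the operator that drops the first d coefficients and shifts the rest down, the
    -- equation reads z + ℓ τ(W z) = 1. It amounts to dividing T^d with remainder by F.
    truncating : ∃ λ (z : PowerSeries) →
      ∀ n → z n ≈ constant 1# n - fromℤ (+ ℓ) * (W ⊛ z) (d ℕ.+ n)
    truncating = fixedPoint Φ contraction , fixedPoint-fixed Φ contraction

    truncating-unit : ∀ (z : PowerSeries) →
      (∀ n → z n ≈ constant 1# n - fromℤ (+ ℓ) * (W ⊛ z) (d ℕ.+ n)) → IsUnit z
    truncating-unit z z≈ = isUnit z λ z₀≃0 → 1≄0 (≃-trans (≃-sym (≃-trans (≈⇒≃ (z≈ 0) 1)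
      (≃-trans (≃-+-cong ≃-refl (≃-neg-cong (≃-zeroˡ ((W ⊛ z) (d ℕ.+ 0)) ℓ≃0)))
        (≈⇒≃ (pointwise λ _ → refl) 1)))) z₀≃0)

  weierstrassPreparation : ∀ d (F : PowerSeries) →
    (∀ n → n < d → F n ≃ 0# [ 1 ]) → ¬ F d ≃ 0# [ 1 ] → WeierstrassFactorization F 0 d
  weierstrassPreparation d F F≃0 Fd≄0 =
    combine (split d F F≃0) (isUnit (λ m → F (d ℕ.+ m))
      (subst (λ n → ¬ F n ≃ 0# [ 1 ]) (sym (ℕ.+-identityʳ d)) Fd≄0))
    where
    V : PowerSeries
    V m = F (d ℕ.+ m)
    combine : (∃ λ (P : PowerSeries) → ∀ n → F n ≈ fromℤ (+ ℓ) * P n + shift d V n) →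
              IsUnit V → WeierstrassFactorization F 0 d
    combine (P , F≈) (Y , VY≋1) = finish (truncating d (P ⊛ Y))
      where
      finish : (∃ λ (z : PowerSeries) →
        ∀ n → z n ≈ constant 1# n - fromℤ (+ ℓ) * ((P ⊛ Y) ⊛ z) (d ℕ.+ n)) →
        WeierstrassFactorization F 0 d
      finish (z , z≈) = invert (truncating-unit d (P ⊛ Y) z z≈)
        where
        invert : IsUnit z → WeierstrassFactorization F 0 d
        invert (Z , zZ≋1) =
            weierstrassFactorization d {F} {P} {V} {Y} {z} {Z} F≈ VY≋1 z≈ zZ≋1

  -- Modulo ℓ the distinguished factor is T^d, so F is congruent to ℓ^μ T^d u. A coefficient prime
  -- to ℓ forces μ = 0, and then d is the order of vanishing of F modulo ℓ. This excludes all other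
  -- values of λ.
  weierstrassDegree : ∀ {F : PowerSeries} {μ d e} → WeierstrassFactorization F μ d →
    (∀ n → n < e → F n ≃ 0# [ 1 ]) → ¬ F e ≃ 0# [ 1 ] → d ≡ e
  weierstrassDegree {F} {μ} {d} {e} (g , u , g-dist , (v , uv≋1) , F≋) F≃0 Fe≄0 = d≡e
    where
    open IsDistinguishedPolynomial g-dist

    g≃Tᵈ : ∀ n → g n ≃ shift d (constant 1#) n [ 1 ]
    g≃Tᵈ n with ℕ.<-cmp n d
    ... | tri< n<d _ _ rewrite shift-< (constant 1#) n<d = ℓ∣ₗ⇒≃0 (divisible n n<d)
    ... | tri≈ _ refl _ rewrite shift-d d (constant 1#) = ≈⇒≃ monic 1
    ... | tri> _ _ d<n = ≃-trans (≈⇒≃ (vanishing n d<n) 1) (≈⇒≃ (≈-sym (beyond d n d<n)) 1)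
      where
      beyond : ∀ d n → d < n → shift d (constant 1#) n ≈ 0#
      beyond zero    (suc n) _         = ≈-refl
      beyond (suc d) (suc n) (s≤s d<n) = beyond d n d<n

    F≃ : ∀ n → F n ≃ fromℤ (ℓ^ μ) * shift d u n [ 1 ]
    F≃ n = ≃-trans (≈⇒≃ (F≋ n) 1) (≃-*-cong ≃-refl (≃-trans
      (⊛-cong-≃ {f = g} {shift d (constant 1#)} {u} {u} n (λ i _ → g≃Tᵈ i) (λ _ _ → ≃-refl))
      (≈⇒≃ (≈-trans (shift-⊛ d (constant 1#) u n) (shift-cong d (⊛-identityˡ u) n)) 1)))

    ℓ^≃0 : ∀ {m} → μ ≡ suc m → fromℤ (ℓ^ μ) ≃ 0# [ 1 ]
    ℓ^≃0 {m} refl = ∣⇒≃0 (subst (+ ℓ ∣_) (sym (ℤ.pos-* ℓ (ℓ ℕ.^ m))) (ℤ∣.∣m⇒∣m*n (ℓ^ m) ℤ∣.∣-refl))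

    μ≡0 : ∀ m → m ≡ μ → μ ≡ 0
    μ≡0 zero    eq = sym eq
    μ≡0 (suc m) eq = contradiction (≃-trans (F≃ e) (≃-zeroˡ (shift d u e) (ℓ^≃0 (sym eq)))) Fe≄0

    u₀≄0 : ¬ u 0 ≃ 0# [ 1 ]
    u₀≄0 u₀≃0 = 1≄0 (≃-trans (≃-sym (≈⇒≃ (uv≋1 0) 1))
      (≃-trans (≃-+-cong (≃-zeroˡ (v 0) u₀≃0) ≃-refl) (≈⇒≃ (pointwise λ _ → refl) 1)))

    d≡e : d ≡ e
    d≡e with ℕ.<-cmp d e
    ... | tri≈ _ d≡e _ = d≡e
    ... | tri> _ _ e<d = contradiction (≃-trans (F≃ e) (subst (λ x → fromℤ (ℓ^ μ) * x ≃ 0# [ 1 ])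
      (sym (shift-< u e<d)) (≈⇒≃ (pointwise λ _ → ℤ.*-zeroʳ (ℓ^ μ)) 1))) Fe≄0
    ... | tri< d<e _ _ = contradiction (≃-trans (≃-sym (≃-trans (F≃ d)
      (subst₂ (λ m x → fromℤ (ℓ^ m) * x ≃ u 0 [ 1 ]) (sym (μ≡0 μ refl)) (sym (shift-d d u))
        (≈⇒≃ (pointwise λ _ → ℤ.*-identityˡ _) 1)))) (F≃0 d d<e)) u₀≄0

-- The first five coefficients of the characteristic series and the resulting invariants.

module Bouquet (ℓ : ℕ) (ℓ-prime : Prime ℓ) where
  open ℓ-adic ℓ ℓ-prime
  open PowerSeriesAlgebra ℓ ℓ-prime
  open Weierstrass ℓ ℓ-prime

  euclid : ∀ a b → + ℓ ∣ a ℤ.* b → + ℓ ∣ a ⊎ + ℓ ∣ b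
  euclid a b ℓ∣ab = Sum.map ℤ∣.∣ᵤ⇒∣ ℤ∣.∣ᵤ⇒∣
    (euclidsLemma ℤ.∣ a ∣ ℤ.∣ b ∣ ℓ-prime (subst (ℓ ℕ∣.∣_) (ℤ.abs-* a b) (ℤ∣.∣⇒∣ᵤ ℓ∣ab)))

  ∣-square : ∀ a → + ℓ ∣ a ℤ.* a → + ℓ ∣ a
  ∣-square a ℓ∣aa = [ id , id ]′ (euclid a a ℓ∣aa)

  -- Cancelling n ! costs at most n ! digits, so residues are compared at level n ! + k and brought
  -- down to level k by coherence.
  !-cancel : ∀ n {x y} → fromℤ (+ (n !)) * x ≈ fromℤ (+ (n !)) * y → x ≈ y
  !-cancel n {x} {y} (mk≈ n!x≡n!y) = mk≈ λ k → mod-trans (mod-sym (coherent+ x k (n !)))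
    (mod-trans (cancel-! n k (n!x≡n!y (n ! ℕ.+ k))) (coherent+ y k (n !)))

  loop : ℤ_ℓ → PowerSeries
  loop b = constant (fromℤ (+ 2)) ⊖ [1+T]^ b ⊖ [1+T]^ (- b)

  -- A binomial coefficient is accessible only through its product with n !. Once denominators are
  -- cleared, each coefficient becomes a polynomial identity over the integers.
  !*loop : ∀ b n → fromℤ (+ (n !)) * loop b n ≈
                   fromℤ (+ (n !)) * constant (fromℤ (+ 2)) n - falling b n - falling (- b) n
  !*loop b n = ≈-trans
    (pointwise λ k → lem (+ (n !)) (residue (constant (fromℤ (+ 2)) n) k)
      (residue (binomial b n) k) (residue (binomial (- b) n) k))
    (+-cong (+-congˡ (neg-cong (proj₂ (!-divides-falling b n))))
            (neg-cong (proj₂ (!-divides-falling (- b) n))))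
    where
    open CommutativeRing +-*-commutativeRing using () renaming (-‿cong to neg-cong)
    lem : ∀ f c x y → f ℤ.* (c ℤ.- x ℤ.- y) ≡ f ℤ.* c ℤ.- f ℤ.* x ℤ.- f ℤ.* y
    lem = solve-∀

  loop₀ : ∀ b → loop b 0 ≈ 0#
  loop₀ b = !-cancel 0 (≈-trans (!*loop b 0) (pointwise λ _ → refl))

  loop₁ : ∀ b → loop b 1 ≈ 0#
  loop₁ b = !-cancel 1 (≈-trans (!*loop b 1) (pointwise λ k → lem (residue b k)))
    where
    lem : ∀ b → + 1 ℤ.* + 0 ℤ.- + 1 ℤ.* (b ℤ.- + 0) ℤ.- + 1 ℤ.* (ℤ.- b ℤ.- + 0) ≡ + 1 ℤ.* + 0
    lem = solve-∀

  loop₂ : ∀ b → loop b 2 ≈ - (b * b)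
  loop₂ b = !-cancel 2 (≈-trans (!*loop b 2) (pointwise λ k → lem (residue b k)))
    where
    lem : ∀ b → + 2 ℤ.* + 0 ℤ.- + 1 ℤ.* (b ℤ.- + 0) ℤ.* (b ℤ.- + 1)
                  ℤ.- + 1 ℤ.* (ℤ.- b ℤ.- + 0) ℤ.* (ℤ.- b ℤ.- + 1)
              ≡ + 2 ℤ.* ℤ.- (b ℤ.* b)
    lem = solve-∀

  loop₃ : ∀ b → loop b 3 ≈ b * b
  loop₃ b = !-cancel 3 (≈-trans (!*loop b 3) (pointwise λ k → lem (residue b k)))
    where
    lem : ∀ b → + 6 ℤ.* + 0 ℤ.- + 1 ℤ.* (b ℤ.- + 0) ℤ.* (b ℤ.- + 1) ℤ.* (b ℤ.- + 2)
                  ℤ.- + 1 ℤ.* (ℤ.- b ℤ.- + 0) ℤ.* (ℤ.- b ℤ.- + 1) ℤ.* (ℤ.- b ℤ.- + 2)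
              ≡ + 6 ℤ.* (b ℤ.* b)
    lem = solve-∀

  -- The factor 24 remains because the coefficient itself, - (b⁴ + 11 b²) / 12, is not a polynomial
  -- with integral coefficients.
  loop₄ : ∀ b → fromℤ (+ 24) * loop b 4 ≈
    - (fromℤ (+ 2) * (b * b * (b * b)) + fromℤ (+ 22) * (b * b))
  loop₄ b = ≈-trans (!*loop b 4) (pointwise λ k → lem (residue b k))
    where
    lem : ∀ b → + 24 ℤ.* + 0
                  ℤ.- + 1 ℤ.* (b ℤ.- + 0) ℤ.* (b ℤ.- + 1) ℤ.* (b ℤ.- + 2) ℤ.* (b ℤ.- + 3)
                  ℤ.- + 1 ℤ.* (ℤ.- b ℤ.- + 0) ℤ.* (ℤ.- b ℤ.- + 1) ℤ.* (ℤ.- b ℤ.- + 2) ℤ.* (ℤ.- b ℤ.- + 3)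
              ≡ ℤ.- (+ 2 ℤ.* (b ℤ.* b ℤ.* (b ℤ.* b)) ℤ.+ + 22 ℤ.* (b ℤ.* b))
    lem = solve-∀

  quartic : ℤ_ℓ → ℤ_ℓ
  quartic b = - (fromℤ (+ 2) * (b * b * (b * b)) + fromℤ (+ 22) * (b * b))

  SingularAt : ℤ → ℤ → Set
  SingularAt a b = + ℓ ∣ a ℤ.* a ℤ.+ b ℤ.* b

  module _ {x y : ℤ_ℓ} {F : PowerSeries}
    (F₀≈ : F 0 ≈ 0#) (F₁≈ : F 1 ≈ 0#)
    (F₂≈ : F 2 ≈ - (x * x) + - (y * y)) (F₃≈ : F 3 ≈ x * x + y * y)
    (24F₄≈ : fromℤ (+ 24) * F 4 ≈ quartic x + quartic y)
    where
    private
      a b : ℤ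
      a = residue x 1
      b = residue y 1

    low-coefficients₂ : ∀ n → n < 2 → F n ≃ 0# [ 1 ]
    low-coefficients₂ 0 _ = ≈⇒≃ F₀≈ 1
    low-coefficients₂ 1 _ = ≈⇒≃ F₁≈ 1
    low-coefficients₂ (suc (suc _)) (s≤s (s≤s ()))

    regular-coefficient : ¬ SingularAt a b → ¬ F 2 ≃ 0# [ 1 ]
    regular-coefficient ¬sing F₂≃0 = ¬sing (subst (+ ℓ ∣_) (lem a b)
      (ℤ∣.∣m⇒∣-m (≃0⇒∣ (≃-trans (≃-sym (≈⇒≃ F₂≈ 1)) F₂≃0))))
      where
      lem : ∀ a b → ℤ.- (ℤ.- (a ℤ.* a) ℤ.+ ℤ.- (b ℤ.* b)) ≡ a ℤ.* a ℤ.+ b ℤ.* b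
      lem = solve-∀

    low-coefficients₄ : SingularAt a b → ∀ n → n < 4 → F n ≃ 0# [ 1 ]
    low-coefficients₄ sing 0 _ = ≈⇒≃ F₀≈ 1
    low-coefficients₄ sing 1 _ = ≈⇒≃ F₁≈ 1
    low-coefficients₄ sing 2 _ =
      ≃-trans (≈⇒≃ F₂≈ 1) (∣⇒≃0 (subst (+ ℓ ∣_) (lem a b) (ℤ∣.∣m⇒∣-m sing)))
      where
      lem : ∀ a b → ℤ.- (a ℤ.* a ℤ.+ b ℤ.* b) ≡ ℤ.- (a ℤ.* a) ℤ.+ ℤ.- (b ℤ.* b)
      lem = solve-∀
    low-coefficients₄ sing 3 _ = ≃-trans (≈⇒≃ F₃≈ 1) (∣⇒≃0 sing)
    low-coefficients₄ sing (suc (suc (suc (suc _)))) (s≤s (s≤s (s≤s (s≤s ()))))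

    -- 24 F₄ = - 2 (a⁴ + b⁴) - 22 (a² + b²) is 4 a² b² modulo a² + b².
    singular-coefficient : 3 ≤ ℓ → SingularAt a b → ¬ + ℓ ∣ a → ¬ + ℓ ∣ b → ¬ F 4 ≃ 0# [ 1 ]
    singular-coefficient 3≤ℓ sing ℓ∤a ℓ∤b F₄≃0 =
      [ (λ ℓ∣4 → ℕ.<⇒≱ 3≤ℓ (ℕ∣.∣⇒≤ (ℤ∣.∣⇒∣ᵤ (∣-square (+ 2) ℓ∣4))))
      , (λ ℓ∣abab → [ ℓ∤a , ℓ∤b ]′ (euclid a b (∣-square (a ℤ.* b) ℓ∣abab)))
      ]′ (euclid (+ 4) (a ℤ.* b ℤ.* (a ℤ.* b)) ℓ∣4abab)
      where
      -- Divisibility is only passed from F₄ to 24 F₄ and 24 is never inverted, so ℓ = 3 needs no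
      -- separate treatment.
      ℓ∣24F₄ : + ℓ ∣ residue (quartic x + quartic y) 1
      ℓ∣24F₄ = ≃0⇒∣ (≃-trans (≃-sym (≈⇒≃ 24F₄≈ 1))
        (≃-trans (≃-*-cong ≃-refl F₄≃0) (≈⇒≃ (pointwise λ _ → refl) 1)))
      lem : ∀ a b →
        ℤ.- (+ 2 ℤ.* (a ℤ.* a ℤ.* (a ℤ.* a)) ℤ.+ + 22 ℤ.* (a ℤ.* a))
        ℤ.+ ℤ.- (+ 2 ℤ.* (b ℤ.* b ℤ.* (b ℤ.* b)) ℤ.+ + 22 ℤ.* (b ℤ.* b))
        ℤ.+ (a ℤ.* a ℤ.+ b ℤ.* b) ℤ.* (+ 2 ℤ.* (a ℤ.* a ℤ.+ b ℤ.* b) ℤ.+ + 22)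
        ≡ + 4 ℤ.* (a ℤ.* b ℤ.* (a ℤ.* b))
      lem = solve-∀
      ℓ∣4abab : + ℓ ∣ + 4 ℤ.* (a ℤ.* b ℤ.* (a ℤ.* b))
      ℓ∣4abab = subst (+ ℓ ∣_) (lem a b)
        (ℤ∣.∣m∣n⇒∣m+n ℓ∣24F₄ (ℤ∣.∣m⇒∣m*n (+ 2 ℤ.* (a ℤ.* a ℤ.+ b ℤ.* b) ℤ.+ + 22) sing))

    regular-factorization : ¬ SingularAt a b → WeierstrassFactorization F 0 2
    regular-factorization ¬sing =
      weierstrassPreparation 2 F low-coefficients₂ (regular-coefficient ¬sing)

    regular-degree : ∀ μ {d} → ¬ SingularAt a b → WeierstrassFactorization F μ d → d ≡ 2
    regular-degree μ ¬sing f =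
      weierstrassDegree {F} {μ} f low-coefficients₂ (regular-coefficient ¬sing)

    singular-factorization : 3 ≤ ℓ → SingularAt a b → ¬ + ℓ ∣ a → ¬ + ℓ ∣ b →
      WeierstrassFactorization F 0 4
    singular-factorization 3≤ℓ sing ℓ∤a ℓ∤b = weierstrassPreparation 4 F
      (low-coefficients₄ sing) (singular-coefficient 3≤ℓ sing ℓ∤a ℓ∤b)

    singular-degree : ∀ μ {d} → 3 ≤ ℓ → SingularAt a b → ¬ + ℓ ∣ a → ¬ + ℓ ∣ b →
      WeierstrassFactorization F μ d → d ≡ 4
    singular-degree μ 3≤ℓ sing ℓ∤a ℓ∤b f = weierstrassDegree {F} {μ} f
      (low-coefficients₄ sing) (singular-coefficient 3≤ℓ sing ℓ∤a ℓ∤b)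

  module _ (α : Vector ℤ_ℓ 2) where
    private
      F : PowerSeries
      F = characteristicSeries α

      F≈loops : ∀ n → F n ≈ loop (α 0F) n + loop (α 1F) n
      F≈loops n = pointwise λ k → cong (λ c → residue (loop (α 0F) n) k ℤ.+ c)
        (ℤ.+-identityʳ (residue (loop (α 1F) n) k))

      F≈ : ∀ n {x y} → loop (α 0F) n ≈ x → loop (α 1F) n ≈ y → F n ≈ x + y
      F≈ n p q = ≈-trans (F≈loops n) (+-cong p q)

    characteristic₀ : characteristicSeries α 0 ≈ 0#
    characteristic₀ = ≈-trans (F≈ 0 (loop₀ (α 0F)) (loop₀ (α 1F))) (pointwise λ _ → refl)

    characteristic₁ : characteristicSeries α 1 ≈ 0#
    characteristic₁ = ≈-trans (F≈ 1 (loop₁ (α 0F)) (loop₁ (α 1F))) (pointwise λ _ → refl)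

    characteristic₂ : characteristicSeries α 2 ≈ - (α 0F * α 0F) + - (α 1F * α 1F)
    characteristic₂ = F≈ 2 (loop₂ (α 0F)) (loop₂ (α 1F))

    characteristic₃ : characteristicSeries α 3 ≈ α 0F * α 0F + α 1F * α 1F
    characteristic₃ = F≈ 3 (loop₃ (α 0F)) (loop₃ (α 1F))

    characteristic₄ : fromℤ (+ 24) * characteristicSeries α 4 ≈ quartic (α 0F) + quartic (α 1F)
    characteristic₄ = begin
      fromℤ (+ 24) * F 4
        ≈⟨ *-congˡ {x = fromℤ (+ 24)} (F≈loops 4) ⟩
      fromℤ (+ 24) * (loop (α 0F) 4 + loop (α 1F) 4)
        ≈⟨ distribˡ (fromℤ (+ 24)) (loop (α 0F) 4) (loop (α 1F) 4) ⟩
      fromℤ (+ 24) * loop (α 0F) 4 + fromℤ (+ 24) * loop (α 1F) 4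
        ≈⟨ +-cong (loop₄ (α 0F)) (loop₄ (α 1F)) ⟩
      quartic (α 0F) + quartic (α 1F) ∎
      where
      open CommutativeRing +-*-commutativeRing using (distribˡ)
      open import Relation.Binary.Reasoning.Setoid setoid

  Singular : Vector ℤ_ℓ 2 → Set
  Singular α = SingularAt (residue (α 0F) 1) (residue (α 1F) 1)

  inadmissible : ∀ {α : Vector ℤ_ℓ 2} → + ℓ ∣ residue (α 0F) 1 → + ℓ ∣ residue (α 1F) 1 → ¬ Admissible α
  inadmissible {α} ℓ∣a ℓ∣b adm = adm λ { 0F → ≃0⇒ℓ∣ₗ (∣⇒≃0 ℓ∣a) ; 1F → ≃0⇒ℓ∣ₗ (∣⇒≃0 ℓ∣b) }

  -- With its mirror image under `singular-sym`, this says that on the singular stratum both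
  -- coordinates vanish modulo ℓ as soon as one does, so that admissibility can be tested on either
  -- of them.
  singular⇒∣ : ∀ a b → SingularAt a b → + ℓ ∣ a → + ℓ ∣ b
  singular⇒∣ a b sing ℓ∣a = ∣-square b (ℤ∣.∣m+n∣m⇒∣n sing (ℤ∣.∣m⇒∣m*n a ℓ∣a))

  singular-sym : ∀ a b → SingularAt a b → SingularAt b a
  singular-sym a b = subst (+ ℓ ∣_) (ℤ.+-comm (a ℤ.* a) (b ℤ.* b))

  module _ (α : Vector ℤ_ℓ 2) where
    private
      a b : ℤ
      a = residue (α 0F) 1
      b = residue (α 1F) 1

      ∤a : Admissible α → Singular α → ¬ + ℓ ∣ a
      ∤a adm sing ℓ∣a = inadmissible {α} ℓ∣a (singular⇒∣ a b sing ℓ∣a) adm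

      ∤b : Admissible α → Singular α → ¬ + ℓ ∣ b
      ∤b adm sing ℓ∣b = inadmissible {α} (singular⇒∣ b a (singular-sym a b sing) ℓ∣b) ℓ∣b adm

    bouquet-regular : ¬ Singular α → WeierstrassFactorization (characteristicSeries α) 0 2
    bouquet-regular = regular-factorization {α 0F} {α 1F} {characteristicSeries α}
      (characteristic₀ α) (characteristic₁ α) (characteristic₂ α) (characteristic₃ α) (characteristic₄ α)

    bouquet-regular-degree : ∀ μ {d} → ¬ Singular α →
      WeierstrassFactorization (characteristicSeries α) μ d → d ≡ 2
    bouquet-regular-degree = regular-degree {α 0F} {α 1F} {characteristicSeries α}
      (characteristic₀ α) (characteristic₁ α) (characteristic₂ α) (characteristic₃ α) (characteristic₄ α)

    bouquet-singular : 3 ≤ ℓ → Admissible α → Singular α →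
      WeierstrassFactorization (characteristicSeries α) 0 4
    bouquet-singular 3≤ℓ adm sing = singular-factorization {α 0F} {α 1F} {characteristicSeries α}
      (characteristic₀ α) (characteristic₁ α) (characteristic₂ α) (characteristic₃ α) (characteristic₄ α)
      3≤ℓ sing (∤a adm sing) (∤b adm sing)

    bouquet-singular-degree : ∀ μ {d} → 3 ≤ ℓ → Admissible α → Singular α →
      WeierstrassFactorization (characteristicSeries α) μ d → d ≡ 4
    bouquet-singular-degree μ 3≤ℓ adm sing = singular-degree {α 0F} {α 1F} {characteristicSeries α}
      (characteristic₀ α) (characteristic₁ α) (characteristic₂ α) (characteristic₃ α) (characteristic₄ α)
      μ 3≤ℓ sing (∤a adm sing) (∤b adm sing)

-- Finite sums and the parity of symmetric matrices.

sum-zero : ∀ {n} (f : Vector ℕ n) → (∀ i → f i ≡ 0) → sum f ≡ 0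
sum-zero {n} f f≡0 = trans (sum-cong-≗ f≡0) (sum-replicate-zero n)

sum-unique : ∀ {n} (f : Vector ℕ n) k → f k ≡ 1 → (∀ j → j ≢ k → f j ≡ 0) → sum f ≡ 1
sum-unique {suc n} f k fk≡1 f≡0 = trans (sum-remove f) (cong₂ ℕ._+_ fk≡1
  (sum-zero (removeAt f k) λ j → f≡0 (punchIn k j) (Fin.punchInᵢ≢i k j)))

-- Entries off the diagonal occur in equal pairs, so the total has the parity of the trace; k is the
-- sum above the diagonal.
sum-symmetric : ∀ {n} (M : Fin n → Fin n → ℕ) → (∀ i j → M i j ≡ M j i) →
  ∃[ k ] sum (λ i → sum (M i)) ≡ sum (λ i → M i i) ℕ.+ 2 ℕ.* k
sum-symmetric {zero}  M M-sym = 0 , refl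
sum-symmetric {suc n} M M-sym =
  let k , eq = sum-symmetric (λ i j → M (suc i) (suc j)) (λ i j → M-sym (suc i) (suc j))
      row = sum (λ j → M zero (suc j))
  in row ℕ.+ k , (begin
    M zero zero ℕ.+ row ℕ.+ sum (λ i → M (suc i) zero ℕ.+ sum (λ j → M (suc i) (suc j)))
      ≡⟨ cong (M zero zero ℕ.+ row ℕ.+_) (∑-distrib-+ (λ i → M (suc i) zero) _) ⟩
    M zero zero ℕ.+ row ℕ.+ (sum (λ i → M (suc i) zero) ℕ.+ sum (λ i → sum (λ j → M (suc i) (suc j))))
      ≡⟨ cong₂ (λ x y → M zero zero ℕ.+ row ℕ.+ (x ℕ.+ y))
           (sum-cong-≗ (λ i → M-sym (suc i) zero)) eq ⟩
    M zero zero ℕ.+ row ℕ.+ (row ℕ.+ (sum (λ i → M (suc i) (suc i)) ℕ.+ 2 ℕ.* k))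
      ≡⟨ lem (M zero zero) row (sum (λ i → M (suc i) (suc i))) k ⟩
    M zero zero ℕ.+ sum (λ i → M (suc i) (suc i)) ℕ.+ 2 ℕ.* (row ℕ.+ k) ∎)
  where
  open ≡-Reasoning
  lem : ∀ m r s k → m ℕ.+ r ℕ.+ (r ℕ.+ (s ℕ.+ 2 ℕ.* k)) ≡ m ℕ.+ s ℕ.+ 2 ℕ.* (r ℕ.+ k)
  lem = ℕ-Solver.solve-∀

indicator : ∀ {P : Set} → Dec P → ℕ
indicator (yes _) = 1
indicator (no _)  = 0

indicator-yes : ∀ {P : Set} (d : Dec P) → P → indicator d ≡ 1
indicator-yes (yes _) p = refl
indicator-yes (no ¬p) p = contradiction p ¬p

indicator-no : ∀ {P : Set} (d : Dec P) → ¬ P → indicator d ≡ 0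
indicator-no (yes p) ¬p = contradiction p ¬p
indicator-no (no _)  ¬p = refl

-- When -1 is a square modulo ℓ.

module SquareRootOf-1 (ℓ : ℕ) (ℓ-prime : Prime ℓ) where
  open Weierstrass ℓ ℓ-prime using (inverse-modℓ)
  open Bouquet ℓ ℓ-prime using (euclid)

  private instance
    ℓ≢0 : ℕ.NonZero ℓ
    ℓ≢0 = prime⇒nonZero ℓ-prime

  ∣-∸ : ∀ {m n} → m ≤ n → n < ℓ → + ℓ ∣ + m ℤ.- + n → m ≡ n
  ∣-∸ {m} {n} m≤n n<ℓ ℓ∣m-n = ℕ.≤-antisym m≤n (ℕ.m∸n≡0⇒m≤n (n∸m≡0 (n ℕ.∸ m) refl))
    where
    ℓ∣n∸m : ℓ ℕ∣.∣ n ℕ.∸ m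
    ℓ∣n∸m = subst (ℓ ℕ∣.∣_) (trans (cong ℤ.∣_∣ (ℤ.m-n≡m⊖n m n)) (ℤ.∣⊖∣-≤ m≤n)) (ℤ∣.∣⇒∣ᵤ ℓ∣m-n)
    n∸m≡0 : ∀ d → d ≡ n ℕ.∸ m → n ℕ.∸ m ≡ 0
    n∸m≡0 zero    eq = sym eq
    n∸m≡0 (suc d) eq = contradiction (subst (ℓ ℕ∣.∣_) (sym eq) ℓ∣n∸m)
      (ℕ∣.>⇒∤ (subst (_< ℓ) (sym eq) (ℕ.≤-<-trans (ℕ.m∸n≤m n m) n<ℓ)))

  residues-unique : ∀ {m n} → m < ℓ → n < ℓ → + ℓ ∣ + m ℤ.- + n → m ≡ n
  residues-unique {m} {n} m<ℓ n<ℓ ℓ∣m-n = [ (λ m≤n → ∣-∸ m≤n n<ℓ ℓ∣m-n)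
    , (λ n≤m → sym (∣-∸ n≤m m<ℓ (subst (+ ℓ ∣_) (lem (+ m) (+ n)) (ℤ∣.∣m⇒∣-m ℓ∣m-n)))) ]′ (ℕ.≤-total m n)
    where
    lem : ∀ a b → ℤ.- (a ℤ.- b) ≡ b ℤ.- a
    lem = solve-∀

  residue-mod : ∀ a → + ℓ ∣ a ℤ.- + (a ℤ/.%ℕ ℓ)
  residue-mod a = divides (a ℤ/./ℕ ℓ)
    (trans (cong (ℤ._- + (a ℤ/.%ℕ ℓ)) (ℤ/.a≡a%ℕn+[a/ℕn]*n a ℓ)) (lem (+ (a ℤ/.%ℕ ℓ)) ((a ℤ/./ℕ ℓ) ℤ.* + ℓ)))
    where
    lem : ∀ r s → (r ℤ.+ s) ℤ.- r ≡ s
    lem = solve-∀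

  -- The numbers 1, …, h with h = (ℓ - 1) / 2 represent the nonzero residues up
  -- to sign, so being mutually inverse up to sign is a symmetric relation on
  -- them with exactly one partner for each; hence h has the parity of the number
  -- of solutions of x⁴ = 1 among them.
  module _ (h′ : ℕ) (ℓ≡ : ℓ ≡ suc (2 ℕ.* suc h′)) where
    private
      h : ℕ
      h = suc h′

      v : Fin h → ℤ
      v k = + suc (toℕ k)

      sq : ℤ → ℤ
      sq a = a ℤ.* a

      v<ℓ : ∀ k → suc (toℕ k) < ℓ
      v<ℓ k = subst (suc (toℕ k) <_) (sym ℓ≡) (s≤s (ℕ.≤-trans (Fin.toℕ<n k) (ℕ.m≤m+n h (h ℕ.+ 0))))

      ℓ∤v : ∀ k → ¬ + ℓ ∣ v k
      ℓ∤v k ℓ∣v = ℕ∣.>⇒∤ (v<ℓ k) (ℤ∣.∣⇒∣ᵤ ℓ∣v)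

      ℓ∤v+v : ∀ i j → ¬ + ℓ ∣ v i ℤ.+ v j
      ℓ∤v+v i j ℓ∣ = ℕ∣.>⇒∤ (subst (suc (toℕ i) ℕ.+ suc (toℕ j) <_) (sym ℓ≡)
        (s≤s (ℕ.+-mono-≤ (Fin.toℕ<n i) (subst (suc (toℕ j) ≤_) (sym (ℕ.+-identityʳ h)) (Fin.toℕ<n j)))))
        (ℤ∣.∣⇒∣ᵤ ℓ∣)

      -- Equal squares mean equality up to sign, and the sign is settled by size: a sum of two
      -- representatives is positive and at most 2 h = ℓ - 1.
      v-unique : ∀ i j → + ℓ ∣ sq (v i) ℤ.- sq (v j) → i ≡ j
      v-unique i j ℓ∣ =
        [ (λ ℓ∣- → Fin.toℕ-injective (ℕ.suc-injective (residues-unique (v<ℓ i) (v<ℓ j) ℓ∣-)))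
        , (λ ℓ∣+ → contradiction ℓ∣+ (ℓ∤v+v i j))
        ]′ (euclid (v i ℤ.- v j) (v i ℤ.+ v j) (subst (+ ℓ ∣_) (lem (v i) (v j)) ℓ∣))
        where
        lem : ∀ a b → a ℤ.* a ℤ.- b ℤ.* b ≡ (a ℤ.- b) ℤ.* (a ℤ.+ b)
        lem = solve-∀

      representative-ℕ : ∀ r → 0 < r → r < ℓ → ∃[ k ] + ℓ ∣ sq (+ r) ℤ.- sq (v k)
      representative-ℕ (suc r) _ 1+r<ℓ with suc r ℕ.≤? h
      ... | yes r<h = fromℕ< r<h ,
          subst (λ n → + ℓ ∣ sq (+ suc r) ℤ.- sq (+ suc n)) (sym (Fin.toℕ-fromℕ< r<h))
            (subst (+ ℓ ∣_) (sym (ℤ.+-inverseʳ (sq (+ suc r)))) (divides (+ 0) refl))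
      ... | no r≮h = fromℕ< d<h , divides (+ suc r ℤ.- + suc d) (trans
          (cong (λ n → sq (+ suc r) ℤ.- sq (+ suc n)) (Fin.toℕ-fromℕ< d<h))
          (trans (lem (+ suc r) (+ suc d)) (cong (λ n → (+ suc r ℤ.- + suc d) ℤ.* + n) r+d≡ℓ)))
        where
        d : ℕ
        -- Index d stands for the number d + 1, which is ℓ - (r + 1), the negative of the given
        -- residue.
        d = ℓ ℕ.∸ suc (suc r)
        r+d≡ℓ : suc r ℕ.+ suc d ≡ ℓ
        r+d≡ℓ = trans (cong suc (ℕ.+-suc r d)) (ℕ.m+[n∸m]≡n 1+r<ℓ)
        d<h : d < h
        d<h = ℕ.+-cancelˡ-≤ h (suc d) h (ℕ.≤-pred (begin
          suc (h ℕ.+ suc d)  ≤⟨ ℕ.+-monoˡ-≤ (suc d) (ℕ.≰⇒> r≮h) ⟩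
          suc r ℕ.+ suc d    ≡⟨ trans r+d≡ℓ ℓ≡ ⟩
          suc (h ℕ.+ (h ℕ.+ 0)) ≡⟨ cong (λ n → suc (h ℕ.+ n)) (ℕ.+-identityʳ h) ⟩
          suc (h ℕ.+ h)      ∎))
          where open ℕ.≤-Reasoning
        lem : ∀ a b → a ℤ.* a ℤ.- b ℤ.* b ≡ (a ℤ.- b) ℤ.* (a ℤ.+ b)
        lem = solve-∀

      representative : ∀ a → ¬ + ℓ ∣ a → ∃[ k ] + ℓ ∣ sq a ℤ.- sq (v k)
      representative a ℓ∤a =
        let k , ℓ∣ = representative-ℕ r 0<r (ℤ/.n%ℕd<d a ℓ)
        in k , subst (+ ℓ ∣_) (lem a (+ r) (v k))
             (ℤ∣.∣m∣n⇒∣m+n (ℤ∣.∣m⇒∣m*n (a ℤ.+ + r) (residue-mod a)) ℓ∣)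
        where
        r : ℕ
        r = a ℤ/.%ℕ ℓ
        0<r : 0 < r
        0<r = ℕ.n≢0⇒n>0 λ r≡0 → ℓ∤a (subst (+ ℓ ∣_) (ℤ.+-identityʳ a)
          (subst (λ n → + ℓ ∣ a ℤ.- + n) r≡0 (residue-mod a)))
        lem : ∀ a r v → (a ℤ.- r) ℤ.* (a ℤ.+ r) ℤ.+ (r ℤ.* r ℤ.- v ℤ.* v) ≡ a ℤ.* a ℤ.- v ℤ.* v
        lem = solve-∀

      -- The product is 1 or -1 modulo ℓ; squaring hides the sign.
      Inverse : Fin h → Fin h → Set
      Inverse i j = + ℓ ∣ sq (v i ℤ.* v j) ℤ.- + 1

      inverse? : ∀ i j → Dec (Inverse i j)
      inverse? i j = + ℓ ℤ∣.∣? sq (v i ℤ.* v j) ℤ.- + 1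

      M : Fin h → Fin h → ℕ
      M i j = indicator (inverse? i j)

      M-sym : ∀ i j → M i j ≡ M j i
      M-sym i j = cong (λ a → indicator (+ ℓ ℤ∣.∣? sq a ℤ.- + 1)) (ℤ.*-comm (v i) (v j))

      inverse : ∀ i → ∃[ k ] Inverse i k
      inverse i =
        let y , ℓ∣vy-1 = inverse-modℓ (v i) (ℓ∤v i)
            k , ℓ∣yy-vv = representative y λ ℓ∣y → ℓ∤v zero (subst (+ ℓ ∣_) (lem₁ (v i ℤ.* y))
              (ℤ∣.∣m∣n⇒∣m-n (ℤ∣.∣n⇒∣m*n (v i) ℓ∣y) ℓ∣vy-1))
        in k , subst (+ ℓ ∣_) (lem₂ (v i) y (v k)) (ℤ∣.∣m∣n⇒∣m-n
             (ℤ∣.∣m⇒∣m*n (v i ℤ.* y ℤ.+ + 1) ℓ∣vy-1) (ℤ∣.∣n⇒∣m*n (sq (v i)) ℓ∣yy-vv))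
        where
        lem₁ : ∀ a → a ℤ.- (a ℤ.- + 1) ≡ + 1
        lem₁ = solve-∀
        lem₂ : ∀ v y w → (v ℤ.* y ℤ.- + 1) ℤ.* (v ℤ.* y ℤ.+ + 1) ℤ.- v ℤ.* v ℤ.* (y ℤ.* y ℤ.- w ℤ.* w)
             ≡ (v ℤ.* w) ℤ.* (v ℤ.* w) ℤ.- + 1
        lem₂ = solve-∀

      inverse-unique : ∀ i j k → Inverse i j → Inverse i k → j ≡ k
      inverse-unique i j k ij ik =
        [ (λ ℓ∣vv → contradiction ([ id , id ]′ (euclid (v i) (v i) ℓ∣vv)) (ℓ∤v i)) , v-unique j k ]′
        (euclid (sq (v i)) (sq (v j) ℤ.- sq (v k))
          (subst (+ ℓ ∣_) (lem (v i) (v j) (v k)) (ℤ∣.∣m∣n⇒∣m-n ij ik)))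
        where
        lem : ∀ u v w → ((u ℤ.* v) ℤ.* (u ℤ.* v) ℤ.- + 1) ℤ.- ((u ℤ.* w) ℤ.* (u ℤ.* w) ℤ.- + 1)
                      ≡ u ℤ.* u ℤ.* (v ℤ.* v ℤ.- w ℤ.* w)
        lem = solve-∀

      row≡1 : ∀ i → sum (M i) ≡ 1
      row≡1 i = let k , ik = inverse i in sum-unique (M i) k (indicator-yes (inverse? i k) ik)
        λ j j≢k → indicator-no (inverse? i j) λ ij → j≢k (inverse-unique i j k ij ik)

      sum-ones : ∀ n → sum {n} (λ _ → 1) ≡ n
      sum-ones zero    = refl
      sum-ones (suc n) = cong suc (sum-ones n)

      h≡trace+2k : ∃[ k ] h ≡ sum (λ i → M i i) ℕ.+ 2 ℕ.* k
      h≡trace+2k = let k , eq = sum-symmetric M M-sym in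
        k , trans (sym (sum-ones h)) (trans (sym (sum-cong-≗ row≡1)) eq)

      M₀₀≡1 : M zero zero ≡ 1
      M₀₀≡1 = indicator-yes (inverse? zero zero) (divides (+ 0) refl)

      -- x⁴ - 1 = (x² - 1)(x² + 1), and among the representatives the first factor vanishes only at
      -- x = 1, which has index zero.
      diagonal : ∀ i → Inverse (suc i) (suc i) → + ℓ ∣ sq (v (suc i)) ℤ.+ + 1
      diagonal i inv = [ (λ ℓ∣ → contradiction (v-unique (suc i) zero ℓ∣) λ ()) , id ]′
        (euclid (sq (v (suc i)) ℤ.- + 1) (sq (v (suc i)) ℤ.+ + 1) (subst (+ ℓ ∣_) (lem (v (suc i))) inv))
        where
        lem : ∀ a → (a ℤ.* a) ℤ.* (a ℤ.* a) ℤ.- + 1 ≡ (a ℤ.* a ℤ.- + 1) ℤ.* (a ℤ.* a ℤ.+ + 1)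
        lem = solve-∀

    -- The representative 1 is then the only nonzero entry of the diagonal, so the trace is 1.
    no-root⇒odd : (∀ r → ¬ + ℓ ∣ r ℤ.* r ℤ.+ + 1) → ∃[ k ] suc h′ ≡ suc (2 ℕ.* k)
    no-root⇒odd no-root = let k , eq = h≡trace+2k in k , trans eq (cong (ℕ._+ 2 ℕ.* k)
      (cong₂ ℕ._+_ M₀₀≡1 (sum-zero _ λ i →
        indicator-no (inverse? (suc i) (suc i)) (no-root (v (suc i)) ∘ diagonal i))))

    -- The diagonal has exactly two nonzero entries, at 1 and at the representative of r up to sign,
    -- so the trace is 2.
    root⇒even : ∀ r → + ℓ ∣ r ℤ.* r ℤ.+ + 1 → ∃[ k ] suc h′ ≡ 2 ℕ.* k
    root⇒even r ℓ∣rr+1 = from-representative (representative r ℓ∤r)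
      where
      ℓ∤r : ¬ + ℓ ∣ r
      ℓ∤r ℓ∣r = ℓ∤v zero (ℤ∣.∣m+n∣m⇒∣n ℓ∣rr+1 (ℤ∣.∣m⇒∣m*n r ℓ∣r))

      root-squared : ∀ k → + ℓ ∣ sq r ℤ.- sq (v k) → + ℓ ∣ sq (v k) ℤ.+ + 1
      root-squared k ℓ∣ = subst (+ ℓ ∣_) (lem r (v k)) (ℤ∣.∣m∣n⇒∣m-n ℓ∣rr+1 ℓ∣)
        where
        lem : ∀ r v → (r ℤ.* r ℤ.+ + 1) ℤ.- (r ℤ.* r ℤ.- v ℤ.* v) ≡ v ℤ.* v ℤ.+ + 1
        lem = solve-∀

      from-representative : (∃[ k ] + ℓ ∣ sq r ℤ.- sq (v k)) → ∃[ k ] suc h′ ≡ 2 ℕ.* k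
      -- Here r² would be both 1 and -1, making ℓ a divisor of 1 + 1.
      from-representative (zero , ℓ∣) = contradiction (root-squared zero ℓ∣) (ℓ∤v+v zero zero)
      from-representative (suc k , ℓ∣) = let m , eq = h≡trace+2k in suc m ,
        trans eq (trans (cong (ℕ._+ 2 ℕ.* m) (cong₂ ℕ._+_ M₀₀≡1 trace′≡1)) (sym (ℕ.*-suc 2 m)))
        where
        root : + ℓ ∣ sq (v (suc k)) ℤ.+ + 1
        root = root-squared (suc k) ℓ∣
        trace′≡1 : sum (λ i → M (suc i) (suc i)) ≡ 1
        trace′≡1 = sum-unique _ k
          (indicator-yes (inverse? (suc k) (suc k)) (subst (+ ℓ ∣_) (lem₁ (v (suc k)))
            (ℤ∣.∣m⇒∣m*n (sq (v (suc k)) ℤ.- + 1) root)))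
          λ j j≢k → indicator-no (inverse? (suc j) (suc j)) λ inv → j≢k (Fin.suc-injective
            (v-unique (suc j) (suc k) (subst (+ ℓ ∣_) (lem₂ (v (suc j)) (v (suc k)))
              (ℤ∣.∣m∣n⇒∣m-n (diagonal j inv) root))))
          where
          lem₁ : ∀ a → (a ℤ.* a ℤ.+ + 1) ℤ.* (a ℤ.* a ℤ.- + 1) ≡ (a ℤ.* a) ℤ.* (a ℤ.* a) ℤ.- + 1
          lem₁ = solve-∀
          lem₂ : ∀ a b → (a ℤ.* a ℤ.+ + 1) ℤ.- (b ℤ.* b ℤ.+ + 1) ≡ a ℤ.* a ℤ.- b ℤ.* b
          lem₂ = solve-∀

    -- A root may be sought among the finitely many representatives. Being decidable, its existence
    -- can be concluded from the parity contradiction that its absence produces.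
    root? : Dec (∃[ r ] + ℓ ∣ r ℤ.* r ℤ.+ + 1)
    root? with Fin.any? (λ k → + ℓ ℤ∣.∣? sq (v k) ℤ.+ + 1)
    ... | yes (k , ℓ∣) = yes (v k , ℓ∣)
    ... | no ¬root = no λ (r , ℓ∣rr+1) →
      let k , ℓ∣ = representative r λ ℓ∣r → ℓ∤v zero (ℤ∣.∣m+n∣m⇒∣n ℓ∣rr+1 (ℤ∣.∣m⇒∣m*n r ℓ∣r))
      in ¬root (k , subst (+ ℓ ∣_) (lem r (v k)) (ℤ∣.∣m∣n⇒∣m-n ℓ∣rr+1 ℓ∣))
      where
      lem : ∀ r v → (r ℤ.* r ℤ.+ + 1) ℤ.- (r ℤ.* r ℤ.- v ℤ.* v) ≡ v ℤ.* v ℤ.+ + 1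
      lem = solve-∀

  2m≢1+2n : ∀ m n → 2 ℕ.* m ≢ suc (2 ℕ.* n)
  2m≢1+2n m n eq = ℕ∣.>⇒∤ (s<s z<s) (ℕ∣.∣m+n∣m⇒∣n
    (subst (2 ℕ∣.∣_) (trans eq (ℕ.+-comm 1 (2 ℕ.* n))) (ℕ∣.m∣m*n m)) (ℕ∣.m∣m*n n))

  ℓ≡3⇒no-root : ℓ % 4 ≡ 3 → ∀ r → ¬ + ℓ ∣ r ℤ.* r ℤ.+ + 1
  ℓ≡3⇒no-root ℓ%4≡3 r ℓ∣rr+1 = let k , eq = root⇒even (2 ℕ.* q) ℓ≡ r ℓ∣rr+1 in
    2m≢1+2n k q (sym eq)
    where
    q : ℕ
    q = ℓ ℕ./ 4
    ℓ≡ : ℓ ≡ suc (2 ℕ.* suc (2 ℕ.* q))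
    ℓ≡ = trans (m≡m%n+[m/n]*n ℓ 4) (trans (cong (ℕ._+ q ℕ.* 4) ℓ%4≡3) (lem q))
      where
      lem : ∀ q → 3 ℕ.+ q ℕ.* 4 ≡ 1 ℕ.+ 2 ℕ.* (1 ℕ.+ 2 ℕ.* q)
      lem = ℕ-Solver.solve-∀

  ℓ≡1⇒root : ℓ % 4 ≡ 1 → 3 ≤ ℓ → ∃[ r ] + ℓ ∣ r ℤ.* r ℤ.+ + 1
  ℓ≡1⇒root ℓ%4≡1 3≤ℓ = go (ℓ ℕ./ 4) (trans (m≡m%n+[m/n]*n ℓ 4) (cong (ℕ._+ ℓ ℕ./ 4 ℕ.* 4) ℓ%4≡1))
    where
    go : ∀ q → ℓ ≡ 1 ℕ.+ q ℕ.* 4 → ∃[ r ] + ℓ ∣ r ℤ.* r ℤ.+ + 1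
    go zero    ℓ≡1 = contradiction (subst (3 ≤_) ℓ≡1 3≤ℓ) (ℕ.<⇒≱ (s<s z<s))
    go (suc q) ℓ≡ = decide (root? h′ ℓ≡′)
      where
      h′ : ℕ
      h′ = suc (2 ℕ.* q)
      ℓ≡′ : ℓ ≡ suc (2 ℕ.* suc h′)
      ℓ≡′ = trans ℓ≡ (lem q)
        where
        lem : ∀ q → 1 ℕ.+ (1 ℕ.+ q) ℕ.* 4 ≡ 1 ℕ.+ 2 ℕ.* (1 ℕ.+ (1 ℕ.+ 2 ℕ.* q))
        lem = ℕ-Solver.solve-∀
      decide : Dec (∃[ r ] + ℓ ∣ r ℤ.* r ℤ.+ + 1) → ∃[ r ] + ℓ ∣ r ℤ.* r ℤ.+ + 1
      decide (yes root)   = root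
      decide (no ¬root) = let k , eq = no-root⇒odd h′ ℓ≡′ (λ r ℓ∣ → ¬root (r , ℓ∣)) in
        contradiction (trans (ℕ.*-suc 2 q) eq) (2m≢1+2n (suc q) k)

-- Rational arithmetic of the volumes.

ℚ-ring : AlmostCommutativeRing 0ℓ 0ℓ
ℚ-ring = fromCommutativeRing ℚ.+-*-commutativeRing λ p → dec⇒maybe (0ℚ ℚ.≟ p)

+[1+n]/1 : ∀ n → + suc n ℚ./ 1 ≡ 1ℚ ℚ.+ + n ℚ./ 1
+[1+n]/1 n = ℚ.toℚᵘ-injective (begin
  toℚᵘ (+ suc n ℚ./ 1)              ≈⟨ ℚ.toℚᵘ-fromℚᵘ (mkℚᵘ (+ suc n) 0) ⟩
  mkℚᵘ (+ suc n) 0                  ≈⟨ *≡* (cong (λ k → (+ 1 ℤ.+ k) ℤ.* + 1) (sym (ℤ.*-identityʳ (+ n)))) ⟩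
  mkℚᵘ (+ 1) 0 ℚᵘ.+ mkℚᵘ (+ n) 0    ≈⟨ ℚᵘ.+-congʳ (mkℚᵘ (+ 1) 0) (ℚ.toℚᵘ-fromℚᵘ (mkℚᵘ (+ n) 0)) ⟨
  toℚᵘ 1ℚ ℚᵘ.+ toℚᵘ (+ n ℚ./ 1)     ≈⟨ ℚ.toℚᵘ-homo-+ 1ℚ (+ n ℚ./ 1) ⟨
  toℚᵘ (1ℚ ℚ.+ + n ℚ./ 1)           ∎)
  where open import Relation.Binary.Reasoning.Setoid ℚᵘ.≃-setoid

n/1≡n×1 : ∀ n → + n ℚ./ 1 ≡ n ×ℚ 1ℚ
n/1≡n×1 zero    = refl
n/1≡n×1 (suc n) = trans (+[1+n]/1 n) (cong (1ℚ ℚ.+_) (n/1≡n×1 n))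

m/n*n≡m : ∀ m n .{{_ : ℕ.NonZero n}} → (+ m ℚ./ n) ℚ.* (n ×ℚ 1ℚ) ≡ m ×ℚ 1ℚ
m/n*n≡m m n@(suc d) = trans (cong (λ x → (+ m ℚ./ n) ℚ.* x) (sym (n/1≡n×1 n)))
  (trans (ℚ.toℚᵘ-injective (begin
  toℚᵘ ((+ m ℚ./ n) ℚ.* (+ n ℚ./ 1))
    ≈⟨ ℚ.toℚᵘ-homo-* (+ m ℚ./ n) (+ n ℚ./ 1) ⟩
  toℚᵘ (+ m ℚ./ n) ℚᵘ.* toℚᵘ (+ n ℚ./ 1)
    ≈⟨ ℚᵘ.*-cong (ℚ.toℚᵘ-fromℚᵘ (mkℚᵘ (+ m) d)) (ℚ.toℚᵘ-fromℚᵘ (mkℚᵘ (+ n) 0)) ⟩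
  mkℚᵘ (+ m) d ℚᵘ.* mkℚᵘ (+ n) 0
    ≈⟨ *≡* (trans (ℤ.*-identityʳ _) (cong (λ k → + m ℤ.* + suc k) (sym (ℕ.*-identityʳ d)))) ⟩
  mkℚᵘ (+ m) 0
    ≈⟨ ℚ.toℚᵘ-fromℚᵘ (mkℚᵘ (+ m) 0) ⟨
  toℚᵘ (+ m ℚ./ 1) ∎)) (n/1≡n×1 m))
  where open import Relation.Binary.Reasoning.Setoid ℚᵘ.≃-setoid

n×v≡n×1*v : ∀ n v → n ×ℚ v ≡ (n ×ℚ 1ℚ) ℚ.* v
n×v≡n×1*v n v = sym (trans (×-assoc-* n 1ℚ v) (cong (n ×ℚ_) (ℚ.*-identityˡ v)))

-- V is the measure of a residue class modulo ℓ = k + 1; the stratum ℓ ∣ a² + b² without the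
-- origin consists of 2 k classes, the stratum ℓ ∤ a² + b² of k².
module Strata (k : ℕ) (V : ℚ) (V*ℓ²≡1 : V ℚ.* (suc k ×ℚ 1ℚ ℚ.* (suc k ×ℚ 1ℚ)) ≡ 1ℚ) where

  private
    K : ℚ
    K = k ×ℚ 1ℚ

    -- With V = ℓ^(-2) one has 1 - V = V (ℓ - 1)(ℓ + 1), and the factor ℓ + 1 cancels the
    -- denominator of the probability p.
    complement : ∀ p N → p ℚ.* (1ℚ ℚ.+ (1ℚ ℚ.+ K)) ≡ N → (1ℚ ℚ.- V) ℚ.* p ≡ V ℚ.* (K ℚ.* N)
    complement p N p*≡N = begin
      (1ℚ ℚ.- V) ℚ.* p
        ≡⟨ cong (λ x → (x ℚ.- V) ℚ.* p) (sym V*ℓ²≡1) ⟩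
      (V ℚ.* ((1ℚ ℚ.+ K) ℚ.* (1ℚ ℚ.+ K)) ℚ.- V) ℚ.* p
        ≡⟨ lem V K p ⟩
      V ℚ.* (K ℚ.* (p ℚ.* (1ℚ ℚ.+ (1ℚ ℚ.+ K))))
        ≡⟨ cong (λ x → V ℚ.* (K ℚ.* x)) p*≡N ⟩
      V ℚ.* (K ℚ.* N) ∎
      where
      open ≡-Reasoning
      lem : ∀ V K p → (V ℚ.* ((1ℚ ℚ.+ K) ℚ.* (1ℚ ℚ.+ K)) ℚ.- V) ℚ.* p
                    ≡ V ℚ.* (K ℚ.* (p ℚ.* (1ℚ ℚ.+ (1ℚ ℚ.+ K))))
      lem = RingSolver.solve-∀ ℚ-ring

    pairs : ∀ m → (k ℕ.* m) ×ℚ V ≡ V ℚ.* (K ℚ.* (m ×ℚ 1ℚ))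
    pairs m = trans (n×v≡n×1*v (k ℕ.* m) V)
      (trans (cong (ℚ._* V) (×1-homo-* k m)) (ℚ.*-comm _ V))

    p₁ p₃ : ℚ
    p₁ = + k ℚ./ suc (suc k)
    p₃ = + 2 ℚ./ suc (suc k)

  m₁ m₃ : ℚ
  m₁ = (1ℚ ℚ.- V) ℚ.* p₁
  m₃ = (1ℚ ℚ.- V) ℚ.* p₃

  regular-volume : (k ℕ.* k) ×ℚ V ≡ m₁
  regular-volume = trans (pairs k) (sym (complement p₁ K (m/n*n≡m k (suc (suc k)))))

  singular-volume : (k ℕ.* 2) ×ℚ V ≡ m₃
  singular-volume = trans (pairs 2) (sym (complement p₃ (2 ×ℚ 1ℚ) (m/n*n≡m 2 (suc (suc k)))))

  private
    total : ∀ {x y} → x ℚ.+ y ℚ.+ V ≡ 1ℚ → V ℚ.+ x ≡ 1ℚ ℚ.- y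
    total {x} {y} eq = trans (lem x y V) (cong (ℚ._- y) eq)
      where
      lem : ∀ x y V → V ℚ.+ x ≡ x ℚ.+ y ℚ.+ V ℚ.- y
      lem = RingSolver.solve-∀ ℚ-ring

    volumes : ∀ {x y} → x ≡ V ℚ.* (K ℚ.* K) → y ≡ V ℚ.* (K ℚ.* (1ℚ ℚ.+ 1ℚ)) → x ℚ.+ y ℚ.+ V ≡ 1ℚ
    volumes refl refl = trans (lem V K) V*ℓ²≡1
      where
      lem : ∀ V K → V ℚ.* (K ℚ.* K) ℚ.+ V ℚ.* (K ℚ.* (1ℚ ℚ.+ 1ℚ)) ℚ.+ V
                  ≡ V ℚ.* ((1ℚ ℚ.+ K) ℚ.* (1ℚ ℚ.+ K))
      lem = RingSolver.solve-∀ ℚ-ring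

    -- The k² regular classes, the 2 k singular ones and the class of the origin make up all (k +
    -- 1)² classes.
    m₁+m₃+V≡1 : (k ℕ.* k) ×ℚ V ℚ.+ (k ℕ.* 2) ×ℚ V ℚ.+ V ≡ 1ℚ
    m₁+m₃+V≡1 = volumes (pairs k) (pairs 2)

  regular-covolume : suc (k ℕ.* 2) ×ℚ V ≡ 1ℚ ℚ.- m₁
  regular-covolume = trans
    (total (trans (cong (ℚ._+ V) (ℚ.+-comm ((k ℕ.* 2) ×ℚ V) ((k ℕ.* k) ×ℚ V))) m₁+m₃+V≡1))
    (cong (λ y → 1ℚ ℚ.- y) regular-volume)

  singular-covolume : suc (k ℕ.* k) ×ℚ V ≡ 1ℚ ℚ.- m₃
  singular-covolume = trans (total m₁+m₃+V≡1) (cong (λ y → 1ℚ ℚ.- y) singular-volume)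

-- Outer measure from finite lists of balls.

module Covers (ℓ : ℕ) (ℓ-prime : Prime ℓ) where
  open ℓ-adic ℓ ℓ-prime
  open Ball

  private instance
    ℓ≢0 : ℕ.NonZero ℓ
    ℓ≢0 = prime⇒nonZero ℓ-prime

  listCover : ∀ {t} → List (Ball t) → Cover t
  listCover []       _       = nothing
  listCover (B ∷ Bs) zero    = just B
  listCover (B ∷ Bs) (suc i) = listCover Bs i

  listCover-⋃ : ∀ {t} {α : Vector ℤ_ℓ t} Bs → Any (λ B → member B α) Bs → ⋃ (listCover Bs) α
  listCover-⋃ (B ∷ Bs) (here α∈B)   = 0 , Maybe.just α∈B
  listCover-⋃ (B ∷ Bs) (there α∈Bs) = let i , α∈ = listCover-⋃ Bs α∈Bs in suc i , α∈

  totalVolume : ∀ {t} → List (Ball t) → ℚ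
  totalVolume []       = 0ℚ
  totalVolume (B ∷ Bs) = volume B ℚ.+ totalVolume Bs

  0≤ℓ^- : ∀ n → 0ℚ ℚ.≤ ℓ^- n
  0≤ℓ^- n = ℚ.nonNegative⁻¹ (ℓ^- n) {{ℚ.normalize-nonNeg 1 (ℓ ℕ.^ n) {{ℓ^≢0 n}}}}

  0≤totalVolume : ∀ {t} (Bs : List (Ball t)) → 0ℚ ℚ.≤ totalVolume Bs
  0≤totalVolume []           = ℚ.≤-refl
  0≤totalVolume {t} (B ∷ Bs) = ℚ.+-mono-≤ (0≤ℓ^- (depth B ℕ.* t)) (0≤totalVolume Bs)

  partialVolume-listCover : ∀ {t} (Bs : List (Ball t)) n →
    partialVolume (listCover Bs) n ℚ.≤ totalVolume Bs
  partialVolume-listCover Bs       zero    = 0≤totalVolume Bs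
  partialVolume-listCover {t} []   (suc n) =
    ℚ.+-mono-≤ (ℚ.≤-refl {0ℚ}) (partialVolume-listCover {t} [] n)
  partialVolume-listCover (B ∷ Bs) (suc n) =
    ℚ.+-mono-≤ (ℚ.≤-refl {volume B}) (partialVolume-listCover Bs n)

  -- A finite cover whose volume is exactly m serves every ε at once.
  outerMeasure : ∀ {t} {S : Pred (Vector ℤ_ℓ t) 0ℓ} {m} (Bs : List (Ball t)) →
    (∀ {α} → S α → Any (λ B → member B α) Bs) → totalVolume Bs ≡ m → OuterMeasure≤ S m
  outerMeasure {m = m} Bs S⊆ vol ε 0<ε =
    listCover Bs , (λ {α} α∈S → listCover-⋃ {α = α} Bs (S⊆ α∈S)) , λ n → begin
    partialVolume (listCover Bs) n ≤⟨ partialVolume-listCover Bs n ⟩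
    totalVolume Bs                 ≡⟨ trans vol (sym (ℚ.+-identityʳ m)) ⟩
    m ℚ.+ 0ℚ                       ≤⟨ ℚ.+-monoʳ-≤ m (ℚ.<⇒≤ 0<ε) ⟩
    m ℚ.+ ε                        ∎
    where open ℚ.≤-Reasoning

  wholeSpace : ∀ t → Ball t
  wholeSpace t = record { centre = λ _ → 0# ; depth = 0 }

  wholeSpace-member : ∀ {t} (α : Vector ℤ_ℓ t) → member (wholeSpace t) α
  wholeSpace-member α j = α j - 0# , *-identityʳ (α j - 0#)
    where
    open RawMagma *-rawMagma using (_,_)
    open CommutativeRing +-*-commutativeRing using (*-identityʳ)

  null-measure : ∀ {t} {S : Pred (Vector ℤ_ℓ t) 0ℓ} → (∀ {α} → ¬ S α) → HasHaarMeasure S 0ℚ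
  null-measure {t} empty = outerMeasure [] (λ α∈S → contradiction α∈S empty) refl
    , outerMeasure (wholeSpace t ∷ []) (λ {α} _ → here (wholeSpace-member α)) refl

-- Residue classes modulo ℓ, sorted by lines through the origin.

module Classes (ℓ : ℕ) (ℓ-prime : Prime ℓ) where
  open ℓ-adic ℓ ℓ-prime
  open PowerSeriesAlgebra ℓ ℓ-prime using (mk≃)
  open Weierstrass ℓ ℓ-prime using (∣⇒mod; ≃⇒∣ₗ)
  open Covers ℓ ℓ-prime
  open Ball

  InClass : Vector ℤ_ℓ 2 → ℤ × ℤ → Set
  InClass α (a , b) = + ℓ ∣ residue (α 0F) 1 ℤ.- a × + ℓ ∣ residue (α 1F) 1 ℤ.- b

  class : ℤ × ℤ → Ball 2
  class (a , b) = record { centre = λ { 0F → fromℤ a ; 1F → fromℤ b } ; depth = 1 }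

  class-member : ∀ {α} c → InClass α c → member (class c) α
  class-member c (ℓ∣a , ℓ∣b) 0F = ≃⇒∣ₗ (mk≃ (∣⇒mod ℓ∣a))
  class-member c (ℓ∣a , ℓ∣b) 1F = ≃⇒∣ₗ (mk≃ (∣⇒mod ℓ∣b))

  classes-volume : ∀ L → totalVolume (List.map class L) ≡ length L ×ℚ ℓ^- 2
  classes-volume []      = refl
  classes-volume (c ∷ L) = cong (ℓ^- 2 ℚ.+_) (classes-volume L)

  classes-measure : ∀ {S : Pred (Vector ℤ_ℓ 2) 0ℓ} {m} n L → length L ≡ n →
    (∀ {α} → S α → Any (InClass α) L) → n ×ℚ ℓ^- 2 ≡ m → OuterMeasure≤ S m
  classes-measure n L refl S⊆ vol = outerMeasure (List.map class L)
    (λ {α} α∈S → Any.map⁺ (Any.map (λ {c} → class-member {α} c) (S⊆ α∈S))) (trans (classes-volume L) vol)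

length-cartesianProductWith : ∀ {A B C : Set} (f : A → B → C) xs ys →
  length (cartesianProductWith f xs ys) ≡ length xs ℕ.* length ys
length-cartesianProductWith f []       ys = refl
length-cartesianProductWith f (x ∷ xs) ys = trans (List.length-++ (List.map (f x) ys))
  (cong₂ ℕ._+_ (List.length-map (f x) ys) (length-cartesianProductWith f xs ys))

module Partition (k : ℕ) (ℓ-prime : Prime (suc k)) where
  open ℓ-adic (suc k) ℓ-prime using (ℤ_ℓ; residue)
  open Weierstrass (suc k) ℓ-prime using (inverse-modℓ)
  open Bouquet (suc k) ℓ-prime using (SingularAt; Singular; euclid; singular⇒∣; ∣-square)
  open SquareRootOf-1 (suc k) ℓ-prime using (residue-mod)
  open Classes (suc k) ℓ-prime

  units : List ℤ
  units = List.map (λ n → + suc n) (upTo k)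

  axis : List (ℤ × ℤ)
  axis = List.map (λ b → + 0 , b) units

  -- The nonzero points of the lines b = a c in the plane over ℤ/ℓ. Together with `axis`, the
  -- vertical line, the ℓ possible slopes exhaust the nonzero vectors.
  lines : List ℤ → List (ℤ × ℤ)
  lines = cartesianProductWith (λ a c → a , a ℤ.* c) units

  length-units : length units ≡ k
  length-units = trans (List.length-map _ (upTo k)) (List.length-upTo k)

  length-axis : length axis ≡ k
  length-axis = trans (List.length-map {B = ℤ × ℤ} (λ b → + 0 , b) units) length-units

  length-lines : ∀ cs → length (lines cs) ≡ k ℕ.* length cs
  length-lines cs = trans (length-cartesianProductWith _ units cs) (cong (ℕ._* length cs) length-units)

  unit-residue : ∀ a → ¬ + suc k ∣ a → ∃[ a′ ] a′ ∈ units × + suc k ∣ a ℤ.- a′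
  unit-residue a ℓ∤a = from-ℕ (a ℤ/.%ℕ suc k) (ℤ/.n%ℕd<d a (suc k)) (residue-mod a)
    where
    from-ℕ : ∀ r → r < suc k → + suc k ∣ a ℤ.- + r → ∃[ a′ ] a′ ∈ units × + suc k ∣ a ℤ.- a′
    from-ℕ zero    _         ℓ∣a-0 = contradiction (subst (+ suc k ∣_) (ℤ.+-identityʳ a) ℓ∣a-0) ℓ∤a
    from-ℕ (suc n) (s≤s n<k) ℓ∣a-r = + suc n , ∈-map⁺ (λ n → + suc n) (∈-upTo⁺ n<k) , ℓ∣a-r

  module _ (α : Vector ℤ_ℓ 2) where
    private
      a b : ℤ
      a = residue (α 0F) 1
      b = residue (α 1F) 1

    line-class : ∀ {c cs} → c ∈ cs → ¬ + suc k ∣ a → + suc k ∣ b ℤ.- a ℤ.* c → Any (InClass α) (lines cs)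
    line-class {c} c∈cs ℓ∤a ℓ∣b-ac = let a′ , a′∈units , ℓ∣a-a′ = unit-residue a ℓ∤a in
      lose (∈-cartesianProductWith⁺ (λ a c → a , a ℤ.* c) a′∈units c∈cs)
        (ℓ∣a-a′ , subst (+ suc k ∣_) (lem a b a′ c) (ℤ∣.∣m∣n⇒∣m+n ℓ∣b-ac (ℤ∣.∣m⇒∣m*n c ℓ∣a-a′)))
      where
      lem : ∀ a b a′ c → (b ℤ.- a ℤ.* c) ℤ.+ (a ℤ.- a′) ℤ.* c ≡ b ℤ.- a′ ℤ.* c
      lem = solve-∀

    zero-class : + suc k ∣ a → + suc k ∣ b → InClass α (+ 0 , + 0)
    zero-class ℓ∣a ℓ∣b = subst (+ suc k ∣_) (sym (ℤ.+-identityʳ a)) ℓ∣a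
                       , subst (+ suc k ∣_) (sym (ℤ.+-identityʳ b)) ℓ∣b

  module _ (r : ℤ) where

    -- The slopes r e of the lines b = r e a with e² ≠ 1.
    regular-ratios regular-slopes : List ℤ
    regular-ratios = + 0 ∷ List.map (λ n → + suc (suc n)) (upTo (k ℕ.∸ 2))
    regular-slopes = List.map (r ℤ.*_) regular-ratios

    regular-classes singular-classes : List (ℤ × ℤ)
    regular-classes  = axis ++ lines regular-slopes
    singular-classes = lines (r ∷ ℤ.- r ∷ [])

    length-regular-slopes : length regular-slopes ≡ suc (k ℕ.∸ 2)
    length-regular-slopes = trans (List.length-map (r ℤ.*_) regular-ratios)
      (cong suc (trans (List.length-map (λ n → + suc (suc n)) (upTo (k ℕ.∸ 2)))
        (List.length-upTo (k ℕ.∸ 2))))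

    length-regular-classes : 2 ≤ k → length regular-classes ≡ k ℕ.* k
    length-regular-classes 2≤k = begin
      length regular-classes                       ≡⟨ List.length-++ axis {lines regular-slopes} ⟩
      length axis ℕ.+ length (lines regular-slopes) ≡⟨ cong₂ ℕ._+_ length-axis (length-lines regular-slopes) ⟩
      k ℕ.+ k ℕ.* length regular-slopes            ≡⟨ cong (λ n → k ℕ.+ k ℕ.* n) length-regular-slopes ⟩
      k ℕ.+ k ℕ.* suc (k ℕ.∸ 2)                    ≡⟨ ℕ.*-suc k (suc (k ℕ.∸ 2)) ⟨
      k ℕ.* suc (suc (k ℕ.∸ 2))                    ≡⟨ cong (k ℕ.*_) (ℕ.m+[n∸m]≡n 2≤k) ⟩
      k ℕ.* k                                      ∎
      where open ≡-Reasoning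

    length-singular-classes : length singular-classes ≡ k ℕ.* 2
    length-singular-classes = length-lines (r ∷ ℤ.- r ∷ [])

  module _ (r : ℤ) (ℓ∣rr+1 : + suc k ∣ r ℤ.* r ℤ.+ + 1) (α : Vector ℤ_ℓ 2) where
    private
      a b : ℤ
      a = residue (α 0F) 1
      b = residue (α 1F) 1

    -- As r² is -1 modulo ℓ, the form a² + b² splits into (b - a r)(b + a r), and each factor gives
    -- one line.
    singular-class : Singular α → ¬ + suc k ∣ a → Any (InClass α) (singular-classes r)
    singular-class sing ℓ∤a =
      [ line-class α (here refl) ℓ∤a
      , line-class α (there (here refl)) ℓ∤a ∘ subst (+ suc k ∣_) (lem₂ a b r)
      ]′ (euclid (b ℤ.- a ℤ.* r) (b ℤ.+ a ℤ.* r)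
        (subst (+ suc k ∣_) (lem₁ a b r) (ℤ∣.∣m∣n⇒∣m-n sing (ℤ∣.∣n⇒∣m*n (a ℤ.* a) ℓ∣rr+1))))
      where
      lem₁ : ∀ a b r → (a ℤ.* a ℤ.+ b ℤ.* b) ℤ.- a ℤ.* a ℤ.* (r ℤ.* r ℤ.+ + 1)
                     ≡ (b ℤ.- a ℤ.* r) ℤ.* (b ℤ.+ a ℤ.* r)
      lem₁ = solve-∀
      lem₂ : ∀ a b r → b ℤ.+ a ℤ.* r ≡ b ℤ.- a ℤ.* (ℤ.- r)
      lem₂ = solve-∀

    singular-slope : ∀ e → + suc k ∣ e ℤ.* e ℤ.- + 1 → + suc k ∣ b ℤ.- a ℤ.* (r ℤ.* e) → Singular α
    singular-slope e ℓ∣ee-1 ℓ∣b-are = subst (+ suc k ∣_) (lem a b r e) (ℤ∣.∣m∣n⇒∣m+n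
      (ℤ∣.∣m⇒∣m*n (b ℤ.+ a ℤ.* (r ℤ.* e)) ℓ∣b-are)
      (ℤ∣.∣n⇒∣m*n (a ℤ.* a) (ℤ∣.∣m∣n⇒∣m-n (ℤ∣.∣m⇒∣m*n (e ℤ.* e) ℓ∣rr+1) ℓ∣ee-1)))
      where
      lem : ∀ a b r e →
        (b ℤ.- a ℤ.* (r ℤ.* e)) ℤ.* (b ℤ.+ a ℤ.* (r ℤ.* e))
        ℤ.+ a ℤ.* a ℤ.* ((r ℤ.* r ℤ.+ + 1) ℤ.* (e ℤ.* e) ℤ.- (e ℤ.* e ℤ.- + 1))
        ≡ a ℤ.* a ℤ.+ b ℤ.* b
      lem = solve-∀

    -- The ratios missing from the list are 1 and k, and k is -1 modulo ℓ. Both have e² = 1 and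
    -- would put α on a singular line.
    regular-slope : ¬ Singular α → ∀ e → e < suc k → + suc k ∣ b ℤ.- a ℤ.* (r ℤ.* + e) →
      r ℤ.* + e ∈ regular-slopes r
    regular-slope ¬sing zero e<ℓ ℓ∣ = here refl
    regular-slope ¬sing (suc zero) e<ℓ ℓ∣ =
      contradiction (singular-slope (+ 1) (divides (+ 0) refl) ℓ∣) ¬sing
    regular-slope ¬sing (suc (suc n)) (s≤s 2+n≤k) ℓ∣ with n ℕ.<? k ℕ.∸ 2
    ... | yes n<k-2 = there (∈-map⁺ (r ℤ.*_) (∈-map⁺ (λ n → + suc (suc n)) (∈-upTo⁺ n<k-2)))
    ... | no n≮k-2 = contradiction (singular-slope (+ suc (suc n)) ℓ∣ee-1 ℓ∣) ¬sing
      where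
      2+n≡k : suc (suc n) ≡ k
      2+n≡k = ℕ.≤-antisym 2+n≤k (ℕ.≤-trans (ℕ.m≤n+m∸n k 2) (s≤s (s≤s (ℕ.≮⇒≥ n≮k-2))))
      ℓ∣ee-1 : + suc k ∣ + suc (suc n) ℤ.* + suc (suc n) ℤ.- + 1
      -- e² - 1 = (e - 1)(e + 1), where e = k and so e + 1 = ℓ.
      ℓ∣ee-1 = divides (+ suc n) (trans (lem (+ suc n)) (cong (λ m → + suc n ℤ.* + suc m) 2+n≡k))
        where
        lem : ∀ m → (+ 1 ℤ.+ m) ℤ.* (+ 1 ℤ.+ m) ℤ.- + 1 ≡ m ℤ.* (+ 1 ℤ.+ (+ 1 ℤ.+ m))
        lem = solve-∀

    regular-class : ¬ Singular α → Any (InClass α) (regular-classes r)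
    regular-class ¬sing = [ on-axis , off-axis ]′ (∣⊎∤ a)
      where
      ∣⊎∤ : ∀ x → + suc k ∣ x ⊎ ¬ + suc k ∣ x
      ∣⊎∤ x with + suc k ℤ∣.∣? x
      ... | yes p = inj₁ p
      ... | no ¬p = inj₂ ¬p

      on-axis : + suc k ∣ a → Any (InClass α) (regular-classes r)
      on-axis ℓ∣a =
        let b′ , b′∈units , ℓ∣b-b′ = unit-residue b λ ℓ∣b →
              ¬sing (ℤ∣.∣m∣n⇒∣m+n (ℤ∣.∣m⇒∣m*n a ℓ∣a) (ℤ∣.∣m⇒∣m*n b ℓ∣b))
        in Any.++⁺ˡ (lose (∈-map⁺ (λ b → + 0 , b) b′∈units)
             (subst (+ suc k ∣_) (sym (ℤ.+-identityʳ a)) ℓ∣a , ℓ∣b-b′))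

      off-axis : ¬ + suc k ∣ a → Any (InClass α) (regular-classes r)
      off-axis ℓ∤a =
        let y , ℓ∣ary-1 = inverse-modℓ (a ℤ.* r) ℓ∤ar
            -- The slope b / a measured in units of r, that is, b / (a r) reduced modulo ℓ.
            e = (b ℤ.* y) ℤ/.%ℕ suc k
            ℓ∣b-are = subst (+ suc k ∣_) (lem a b r y (+ e)) (ℤ∣.∣m∣n⇒∣m-n
              (ℤ∣.∣n⇒∣m*n (a ℤ.* r) (residue-mod (b ℤ.* y))) (ℤ∣.∣n⇒∣m*n b ℓ∣ary-1))
        in Any.++⁺ʳ axis
             (line-class α (regular-slope ¬sing e (ℤ/.n%ℕd<d (b ℤ.* y) (suc k)) ℓ∣b-are) ℓ∤a ℓ∣b-are)
        where
        ℓ∤r : ¬ + suc k ∣ r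
        ℓ∤r ℓ∣r = ℓ∤a (subst (+ suc k ∣_) (ℤ.*-identityʳ a)
          (ℤ∣.∣n⇒∣m*n a (ℤ∣.∣m+n∣m⇒∣n ℓ∣rr+1 (ℤ∣.∣m⇒∣m*n r ℓ∣r))))
        ℓ∤ar : ¬ + suc k ∣ a ℤ.* r
        ℓ∤ar ℓ∣ar = [ ℓ∤a , ℓ∤r ]′ (euclid a r ℓ∣ar)
        lem : ∀ a b r y e → a ℤ.* r ℤ.* (b ℤ.* y ℤ.- e) ℤ.- b ℤ.* (a ℤ.* r ℤ.* y ℤ.- + 1)
                          ≡ b ℤ.- a ℤ.* (r ℤ.* e)
        lem = solve-∀

-- Invariants on each stratum and their probabilities.

module Invariants (k : ℕ) (ℓ-prime : Prime (suc k)) (3≤ℓ : 3 ≤ suc k) where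
  open ℓ-adic (suc k) ℓ-prime
  open Weierstrass (suc k) ℓ-prime using (inverse-modℓ; ≃0⇒∣; ℓ∣ₗ⇒≃0)
  open Bouquet (suc k) ℓ-prime
  open SquareRootOf-1 (suc k) ℓ-prime
  open Covers (suc k) ℓ-prime
  open Classes (suc k) ℓ-prime
  open Partition k ℓ-prime

  Level : ℤ → Pred (Vector ℤ_ℓ 2) 0ℓ
  Level λ₀ α = Admissible α × IsMu α 0 × IsLambda α λ₀

  singular? : ∀ α → Dec (Singular α)
  singular? α = + suc k ℤ∣.∣? _

  ∣-residue : ∀ {x} → fromℤ (+ suc k) ∣ₗ x → + suc k ∣ residue x 1
  ∣-residue ℓ∣x = ≃0⇒∣ (ℓ∣ₗ⇒≃0 ℓ∣x)

  regular⇒admissible : ∀ α → ¬ Singular α → Admissible α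
  regular⇒admissible α ¬sing ℓ∣α = ¬sing (ℤ∣.∣m∣n⇒∣m+n
    (ℤ∣.∣m⇒∣m*n (residue (α 0F) 1) (∣-residue (ℓ∣α 0F)))
    (ℤ∣.∣m⇒∣m*n (residue (α 1F) 1) (∣-residue (ℓ∣α 1F))))

  μ≡0 : ∀ α → Admissible α → IsMu α 0
  μ≡0 α adm = case singular? α of λ where
    (yes sing) → 4 , bouquet-singular α 3≤ℓ adm sing
    (no ¬sing) → 2 , bouquet-regular α ¬sing

  regular⇒λ≡1 : ∀ α → ¬ Singular α → IsLambda α (+ 1)
  regular⇒λ≡1 α ¬sing = 0 , 2 , bouquet-regular α ¬sing , refl

  singular⇒λ≡3 : ∀ α → Admissible α → Singular α → IsLambda α (+ 3)
  singular⇒λ≡3 α adm sing = 0 , 4 , bouquet-singular α 3≤ℓ adm sing , refl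

  regular-λ : ∀ α {λ₀} → ¬ Singular α → IsLambda α λ₀ → λ₀ ≡ + 1
  regular-λ α ¬sing (μ , d , f , λ₀≡) =
    trans λ₀≡ (cong (λ d → + d ℤ.- + 1) (bouquet-regular-degree α μ ¬sing f))

  singular-λ : ∀ α {λ₀} → Admissible α → Singular α → IsLambda α λ₀ → λ₀ ≡ + 3
  singular-λ α adm sing (μ , d , f , λ₀≡) =
    trans λ₀≡ (cong (λ d → + d ℤ.- + 1) (bouquet-singular-degree α μ 3≤ℓ adm sing f))

  -- For an admissible singular α the quotient b / a exists modulo ℓ and would be a square root of
  -- -1.
  no-root⇒regular : (∀ r → ¬ + suc k ∣ r ℤ.* r ℤ.+ + 1) → ∀ α → Admissible α → ¬ Singular α
  no-root⇒regular no-root α adm sing =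
    let y , ℓ∣ay-1 = inverse-modℓ a λ ℓ∣a → inadmissible {α} ℓ∣a (singular⇒∣ a b sing ℓ∣a) adm
    in no-root (b ℤ.* y) (subst (+ suc k ∣_) (lem a b y) (ℤ∣.∣m∣n⇒∣m-n
         (ℤ∣.∣m⇒∣m*n (y ℤ.* y) sing) (ℤ∣.∣m⇒∣m*n (a ℤ.* y ℤ.+ + 1) ℓ∣ay-1)))
    where
    a b : ℤ
    a = residue (α 0F) 1
    b = residue (α 1F) 1
    lem : ∀ a b y → (a ℤ.* a ℤ.+ b ℤ.* b) ℤ.* (y ℤ.* y) ℤ.- (a ℤ.* y ℤ.- + 1) ℤ.* (a ℤ.* y ℤ.+ + 1)
                  ≡ (b ℤ.* y) ℤ.* (b ℤ.* y) ℤ.+ + 1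
    lem = solve-∀

  V : ℚ
  V = ℓ^- 2

  V*ℓ²≡1 : V ℚ.* ((suc k ×ℚ 1ℚ) ℚ.* (suc k ×ℚ 1ℚ)) ≡ 1ℚ
  V*ℓ²≡1 = trans (cong (V ℚ.*_) (sym (trans
      (cong (_×ℚ 1ℚ) (cong (suc k ℕ.*_) (ℕ.*-identityʳ (suc k)))) (×1-homo-* (suc k) (suc k)))))
    (m/n*n≡m 1 (suc k ℕ.^ 2) {{ℓ^≢0 2}})

  open Strata k V V*ℓ²≡1

  1/[1-V] : ℚ
  1/[1-V] = (ℚ.1/ (1ℚ ℚ.- V)) {{1-ℓ^-t≢0 2}}

  probability : ∀ λ₀ p → HasHaarMeasure (Level λ₀) ((1ℚ ℚ.- V) ℚ.* p) → IsProbability {2} 0 λ₀ p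
  probability λ₀ p haar = (1ℚ ℚ.- V) ℚ.* p , haar , sym (begin
    1/[1-V] ℚ.* ((1ℚ ℚ.- V) ℚ.* p) ≡⟨ ℚ.*-assoc 1/[1-V] (1ℚ ℚ.- V) p ⟨
    1/[1-V] ℚ.* (1ℚ ℚ.- V) ℚ.* p   ≡⟨ cong (ℚ._* p) (ℚ.*-inverseˡ (1ℚ ℚ.- V) {{1-ℓ^-t≢0 2}}) ⟩
    1ℚ ℚ.* p                       ≡⟨ ℚ.*-identityˡ p ⟩
    p                              ∎)
    where
    open ≡-Reasoning

  -- ¬ ℓ ∣ α₀ rather than admissibility: on the singular stratum they agree.
  Stratum : Vector ℤ_ℓ 2 → Set
  Stratum α = ¬ Singular α ⊎ InClass α (+ 0 , + 0) ⊎ (Singular α × ¬ + suc k ∣ residue (α 0F) 1)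

  stratum : ∀ α → Stratum α
  stratum α = from-dec (singular? α) (+ suc k ℤ∣.∣? residue (α 0F) 1)
    where
    from-dec : Dec (Singular α) → Dec (+ suc k ∣ residue (α 0F) 1) → Stratum α
    from-dec (no ¬sing) _         = inj₁ ¬sing
    from-dec (yes sing) (no ℓ∤a)  = inj₂ (inj₂ (sing , ℓ∤a))
    from-dec (yes sing) (yes ℓ∣a) = inj₂ (inj₁ (zero-class α ℓ∣a
      (singular⇒∣ (residue (α 0F) 1) (residue (α 1F) 1) sing ℓ∣a)))

  module _ (r : ℤ) (ℓ∣rr+1 : + suc k ∣ r ℤ.* r ℤ.+ + 1) where
    private
      2≤k : 2 ≤ k
      2≤k = ℕ.s≤s⁻¹ 3≤ℓ

    -- The cover of the level set rests on uniqueness of λ, which keeps singular vectors out of it.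
    -- The cover of the complement rests on existence, which puts every regular vector into the
    -- level set and leaves only the singular classes and the origin.
    regular-haar : HasHaarMeasure (Level (+ 1)) m₁
    regular-haar =
        classes-measure {Level (+ 1)} {m₁} (k ℕ.* k) (regular-classes r)
          (length-regular-classes r 2≤k) inside regular-volume
      , classes-measure {∁ (Level (+ 1))} {1ℚ ℚ.- m₁} (suc (k ℕ.* 2)) ((+ 0 , + 0) ∷ singular-classes r)
          (cong suc (length-singular-classes r)) outside regular-covolume
      where
      inside : ∀ {α} → Level (+ 1) α → Any (InClass α) (regular-classes r)
      inside {α} (adm , _ , λ≡1) = regular-class r ℓ∣rr+1 α λ sing →
        contradiction (singular-λ α adm sing λ≡1) λ ()
      outside : ∀ {α} → ¬ Level (+ 1) α → Any (InClass α) ((+ 0 , + 0) ∷ singular-classes r)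
      outside {α} ∉ = case stratum α of λ where
        (inj₁ ¬sing) → let adm = regular⇒admissible α ¬sing in
          contradiction (adm , μ≡0 α adm , regular⇒λ≡1 α ¬sing) ∉
        (inj₂ (inj₁ α∈0))          → here α∈0
        (inj₂ (inj₂ (sing , ℓ∤a))) → there (singular-class r ℓ∣rr+1 α sing ℓ∤a)

    singular-haar : HasHaarMeasure (Level (+ 3)) m₃
    singular-haar =
        classes-measure {Level (+ 3)} {m₃} (k ℕ.* 2) (singular-classes r)
          (length-singular-classes r) inside singular-volume
      , classes-measure {∁ (Level (+ 3))} {1ℚ ℚ.- m₃} (suc (k ℕ.* k)) ((+ 0 , + 0) ∷ regular-classes r)
          (cong suc (length-regular-classes r 2≤k)) outside singular-covolume
      where
      inside : ∀ {α} → Level (+ 3) α → Any (InClass α) (singular-classes r)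
      inside {α} (adm , _ , λ≡3) = case singular? α of λ where
        (no ¬sing) → contradiction (regular-λ α ¬sing λ≡3) λ ()
        (yes sing) → singular-class r ℓ∣rr+1 α sing λ ℓ∣a → inadmissible {α} ℓ∣a
          (singular⇒∣ (residue (α 0F) 1) (residue (α 1F) 1) sing ℓ∣a) adm
      outside : ∀ {α} → ¬ Level (+ 3) α → Any (InClass α) ((+ 0 , + 0) ∷ regular-classes r)
      outside {α} ∉ = case stratum α of λ where
        (inj₁ ¬sing)               → there (regular-class r ℓ∣rr+1 α ¬sing)
        (inj₂ (inj₁ α∈0))          → here α∈0
        (inj₂ (inj₂ (sing , ℓ∤a))) →
          let adm : Admissible α
              adm = λ ℓ∣α → ℓ∤a (∣-residue (ℓ∣α 0F))
          in contradiction (adm , μ≡0 α adm , singular⇒λ≡3 α adm sing) ∉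
    regular-probability : IsProbability {2} 0 (+ 1) (+ k / suc (suc k))
    regular-probability = probability (+ 1) (+ k / suc (suc k)) regular-haar

    singular-probability : IsProbability {2} 0 (+ 3) (+ 2 / suc (suc k))
    singular-probability = probability (+ 3) (+ 2 / suc (suc k)) singular-haar

  otherwise-empty : ∀ {λ₀} → λ₀ ≢ + 1 → λ₀ ≢ + 3 → ∀ {α} → ¬ Level λ₀ α
  otherwise-empty ≢1 ≢3 {α} (adm , _ , λ≡) = case singular? α of λ where
    (yes sing) → ≢3 (singular-λ α adm sing λ≡)
    (no ¬sing) → ≢1 (regular-λ α ¬sing λ≡)

  otherwise-probability : ∀ λ₀ → λ₀ ≢ + 1 → λ₀ ≢ + 3 → IsProbability {2} 0 λ₀ 0ℚ
  otherwise-probability λ₀ ≢1 ≢3 =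
    0ℚ , null-measure {S = Level λ₀} (otherwise-empty ≢1 ≢3) , sym (ℚ.*-zeroʳ 1/[1-V])

  no-root⇒λ≡1 : (∀ r → ¬ + suc k ∣ r ℤ.* r ℤ.+ + 1) → ∀ α → Admissible α → IsLambda α (+ 1)
  no-root⇒λ≡1 no-root α adm = regular⇒λ≡1 α (no-root⇒regular no-root α adm)

  root⇒probabilities : (∃[ r ] + suc k ∣ r ℤ.* r ℤ.+ + 1) →
    IsProbability {2} 0 (+ 1) (+ k / suc (suc k))
    × IsProbability {2} 0 (+ 3) (+ 2 / suc (suc k))
    × (∀ λ₀ → λ₀ ≢ + 1 → λ₀ ≢ + 3 → IsProbability {2} 0 λ₀ 0ℚ)
  root⇒probabilities (r , ℓ∣rr+1) =
    regular-probability r ℓ∣rr+1 , singular-probability r ℓ∣rr+1 , otherwise-probability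

proposition4p19 : (ℓ : ℕ) (ℓ-prime : Prime ℓ) → 3 ≤ ℓ →
    let open ℓ-adic ℓ ℓ-prime in
    ((α : Vector ℤ_ℓ 2) → Admissible α → IsMu α 0)
    × (ℓ % 4 ≡ 3 → (α : Vector ℤ_ℓ 2) → Admissible α → IsLambda α (+ 1))
    × (ℓ % 4 ≡ 1 →
    IsProbability {2} 0 (+ 1) ((+ ℓ ℤ.- + 1) / suc ℓ)
    × IsProbability {2} 0 (+ 3) (+ 2 / suc ℓ)
    × ((λ₀ : ℤ) → λ₀ ≢ + 1 → λ₀ ≢ + 3 → IsProbability {2} 0 λ₀ 0ℚ))
-- Writing ℓ as `suc k` lets (ℓ - 1) / (ℓ + 1) compute to k / (k + 2).
proposition4p19 (suc k) ℓ-prime 3≤ℓ =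
    Invariants.μ≡0 k ℓ-prime 3≤ℓ
  , Invariants.no-root⇒λ≡1 k ℓ-prime 3≤ℓ ∘ SquareRootOf-1.ℓ≡3⇒no-root (suc k) ℓ-prime
  , λ ℓ%4≡1 → Invariants.root⇒probabilities k ℓ-prime 3≤ℓ
      (SquareRootOf-1.ℓ≡1⇒root (suc k) ℓ-prime ℓ%4≡1 3≤ℓ)
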